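{- Let $G$ be a connected unicyclic graph. Then $\Gamma_{pr}(G)=2\Gamma(G)$ if and only if $G\in\{C_3, C_5, K_{1,t}^{*1}\}$ (for some $t$).
   Context: All graphs are finite, simple and undirected. A graph is unicyclic if it is connected and contains exactly one cycle. A set $D\subseteq V(G)$ is dominating if every vertex is in $D$ or adjacent to a vertex of $D$; it is minimal if no proper subset is dominating. $\Gamma(G)$ is the maximum cardinality of a minimal dominating set of $G$. A paired dominating set (PDS) is a dominating set $D$ such that $G[D]$ has a perfect matching; a PDS is minimal if no proper subset is a PDS. $\Gamma_{pr}(G)$ is the maximum cardinality of a minimal PDS. The subdivided star $K_{1,t}^*$ is obtained from the star $K_{1,t}$ by subdividing every edge once; $K_{1,t}^{*1}$ is the graph obtained from $K_{1,t}^*$ by attaching one triangle to its central vertex (i.e., adding two new adjacent vertices both adjacent to the central vertex). -}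

module Defs where

open import Data.Nat using (ℕ; zero; suc; _+_; _*_; _≤_; _<ᵇ_; _≡ᵇ_; _%_; NonZero)
open import Data.Bool using (Bool; true; false; _∧_; _∨_; not)
open import Data.Fin using (Fin; toℕ)
open import Data.Fin.Subset using (Subset; _∈_; _⊂_; ∣_∣)
open import Data.List using (List; []; _∷_; _++_; [_]; length)
open import Data.List.Relation.Unary.All using (All)
open import Data.List.Relation.Unary.Unique.Propositional using (Unique)
import Data.List.Membership.Propositional as LM
open import Data.Product using (Σ; ∃; _×_; _,_)
open import Data.Sum using (_⊎_)
open import Relation.Nullary using (¬_)
open import Relation.Binary.PropositionalEquality using (_≡_; _≢_)
open import Relation.Binary.Construct.Closure.ReflexiveTransitive using (Star)
open import Function.Bundles using (_↔_; _⇔_; Inverse)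

Graph : ℕ → Set
Graph n = Fin n → Fin n → Bool

Adj : ∀ {n} → Graph n → Fin n → Fin n → Set
Adj G u v = G u v ≡ true

IsSimple : ∀ {n} → Graph n → Set
IsSimple G = (∀ u v → G u v ≡ G v u) × (∀ v → G v v ≡ false)

Connected : ∀ {n} → Graph n → Set
Connected G = ∀ u v → Star (Adj G) u v

pairs : ∀ {A : Set} → List A → List (A × A)
pairs [] = []
pairs (a ∷ []) = []
pairs (a ∷ b ∷ r) = (a , b) ∷ pairs (b ∷ r)

cycEdges : ∀ {A : Set} → List A → List (A × A)
cycEdges [] = []
cycEdges (x ∷ xs) = pairs (x ∷ xs ++ [ x ])

IsCycle : ∀ {n} → Graph n → List (Fin n) → Set
IsCycle G vs = (3 ≤ length vs) × Unique vs × All (λ e → Adj G (Data.Product.proj₁ e) (Data.Product.proj₂ e)) (cycEdges vs)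

CycleEdge : ∀ {n} → List (Fin n) → Fin n → Fin n → Set
CycleEdge vs u v = LM._∈_ (u , v) (cycEdges vs) ⊎ LM._∈_ (v , u) (cycEdges vs)

-- connected and containing exactly one cycle (cycles identified as subgraphs, i.e. by edge sets)
Unicyclic : ∀ {n} → Graph n → Set
Unicyclic {n} G =
  Connected G ×
  (∃ λ c → IsCycle G c) ×
  (∀ c₁ c₂ → IsCycle G c₁ → IsCycle G c₂ → ∀ u v → CycleEdge c₁ u v ⇔ CycleEdge c₂ u v)

Dominating : ∀ {n} → Graph n → Subset n → Set
Dominating {n} G D = ∀ v → v ∈ D ⊎ (∃ λ u → u ∈ D × Adj G u v)

MinimalDominating : ∀ {n} → Graph n → Subset n → Set
MinimalDominating G D = Dominating G D × (∀ S → S ⊂ D → ¬ Dominating G S)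

HasPerfectMatching : ∀ {n} → Graph n → Subset n → Set
HasPerfectMatching {n} G D =
  Σ (Fin n → Fin n) λ m →
    ∀ v → v ∈ D → (m v ∈ D) × (m v ≢ v) × Adj G v (m v) × (m (m v) ≡ v)

PairedDominating : ∀ {n} → Graph n → Subset n → Set
PairedDominating G D = Dominating G D × HasPerfectMatching G D

MinimalPairedDominating : ∀ {n} → Graph n → Subset n → Set
MinimalPairedDominating G D = PairedDominating G D × (∀ S → S ⊂ D → ¬ PairedDominating G S)

IsMax : ∀ {n} → (Subset n → Set) → ℕ → Set
IsMax P k = (∃ λ D → P D × ∣ D ∣ ≡ k) × (∀ D → P D → ∣ D ∣ ≤ k)

IsUpperDomination : ∀ {n} → Graph n → ℕ → Set
IsUpperDomination G = IsMax (MinimalDominating G)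

IsUpperPairedDomination : ∀ {n} → Graph n → ℕ → Set
IsUpperPairedDomination G = IsMax (MinimalPairedDominating G)

_≅_ : ∀ {n m} → Graph n → Graph m → Set
_≅_ {n} {m} G H = Σ (Fin n ↔ Fin m) λ φ → ∀ u v → Adj G u v ⇔ Adj H (Inverse.to φ u) (Inverse.to φ v)

cycleGraph : (k : ℕ) → .{{NonZero k}} → Graph k
cycleGraph k u v = ((suc (toℕ u) % k) ≡ᵇ toℕ v) ∨ ((suc (toℕ v) % k) ≡ᵇ toℕ u)

-- K_{1,t}^{*1} on 2t+3 vertices:
--   0 = centre, 1 and 2 = triangle vertices,
--   3+i (i<t) = subdivision vertices, 3+t+i (i<t) = leaves
starTriEdge : ℕ → ℕ → ℕ → Bool
starTriEdge t a b =
  ((a ≡ᵇ 0) ∧ ((b ≡ᵇ 1) ∨ (b ≡ᵇ 2) ∨ ((2 <ᵇ b) ∧ (b <ᵇ 3 + t))))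
  ∨ ((a ≡ᵇ 1) ∧ (b ≡ᵇ 2))
  ∨ ((2 <ᵇ a) ∧ (a <ᵇ 3 + t) ∧ (b ≡ᵇ a + t))

subdividedStarTriangle : (t : ℕ) → Graph (3 + t + t)
subdividedStarTriangle t u v = starTriEdge t (toℕ u) (toℕ v) ∨ starTriEdge t (toℕ v) (toℕ u)

{-# OPTIONS --safe #-}
module Submission where

-- Deleting a vertex of the cycle leaves a forest, which has an independent set on at
-- least half of its vertices; as independent sets have at most Γ vertices, n ≤ 2Γ + 1.
-- Hence a minimal paired dominating set D with |D| = 2Γ misses at most one vertex.
-- Call an edge inside D that is not a matching edge a cross edge.  If s s′ is one, then
-- s and s′ can be matched with each other and their mates dropped from D, so by minimality
-- some vertex outside D is dominated by these two mates only.  In particular D ≠ V, say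
-- D = V \ {c}.  Without cross edges G consists of c and pairs attached to it, exactly one
-- of them by two edges: this is K*¹.  With a cross edge s s′, c is adjacent to the mates
-- of both, giving C₅, or of only one, and then an independent set of size Γ + 1 exists.
-- Conversely Γpr ≤ 2Γ always, since a minimal dominating subset of a minimal paired
-- dominating set D meets every matched pair of D.  In the listed graphs n is odd,
-- 2Γ ≤ n, and V minus one vertex is a minimal paired dominating set.

open import Defs
open import Data.Bool using (Bool; true; false; _∨_)
import Data.Bool as Bool
open import Data.Bool.Properties using (¬-not)
open import Data.Nat using (ℕ; zero; suc; _+_; _*_; _≤_; _<_; _<ᵇ_; _≡ᵇ_; z≤n; s≤s; s≤s⁻¹)
import Data.Nat.Properties as ℕ
open import Data.Fin using (Fin; zero; suc; toℕ)
import Data.Fin as Fin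
import Data.Fin.Properties as Fin
open import Data.Fin.Patterns using (0F; 1F; 2F; 3F; 4F)
open import Data.Fin.Permutation using (↔⇒≡)
open import Data.Fin.Subset using (Subset; inside; outside; _∈_; _∉_; _⊆_; _⊂_; ∣_∣; _∪_; _-_; ∁; ⊥; ⁅_⁆; Nonempty; Empty)
open import Data.Fin.Subset.Properties
open import Data.Fin.Subset.Induction using (⊂-wellFounded; ⊃-wellFounded)
open import Data.List using (List; []; _∷_; _++_; [_]; length; lookup; filter; allFin)
open import Data.List.Properties using (++-assoc)
import Data.List.Membership.Propositional as List
open import Data.List.Membership.Propositional.Properties
  using (∈-∃++; ∈-++⁻; ∈-++⁺ˡ; ∈-++⁺ʳ; ∈-lookup; ∈-filter⁺; ∈-filter⁻; ∈-allFin)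
open import Data.List.Relation.Unary.Any using (here; there; index)
open import Data.List.Relation.Unary.Any.Properties using (lookup-index)
open import Data.List.Relation.Unary.All as All using (All; []; _∷_)
import Data.List.Relation.Unary.All.Properties as All
open import Data.List.Relation.Unary.AllPairs using ([]; _∷_)
open import Data.List.Relation.Unary.Unique.Propositional using (Unique)
import Data.List.Relation.Unary.Unique.Propositional.Properties as Unique
open import Data.Product using (∃; ∃₂; _×_; _,_; proj₁; proj₂; uncurry)
open import Data.Sum using (_⊎_; inj₁; inj₂; [_,_]′)
open import Data.Vec using (_∷_; []; tabulate; here; there)
open import Data.Vec.Properties using (lookup∘tabulate; lookup⇒[]=; []=⇒lookup)
open import Function using (_∘_; id; case_of_; Equivalence; Inverse; _⇔_; mk⇔; mk↔ₛ′)
open import Function.Construct.Identity using (↔-id)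
open import Function.Properties.Equivalence using () renaming (sym to ⇔-sym; trans to ⇔-trans)
open import Induction.WellFounded using (Acc; acc)
open import Relation.Binary.Construct.Closure.ReflexiveTransitive using (Star; ε; _◅_)
open import Relation.Binary.PropositionalEquality
  using (_≡_; _≢_; refl; sym; trans; cong; cong₂; subst; subst₂; ≢-sym)
open import Relation.Nullary using (¬_; Dec; yes; no; does; proof; invert; contradiction; Reflects)
open import Relation.Nullary.Decidable
  using (dec-true; dec-false; _×-dec_; _⊎-dec_; ¬?; _→-dec_; decidable-stable; toWitness; toWitnessFalse)
open import Relation.Unary using (Decidable)

private variable
  n m : ℕ
  A : Set
  P : A × A → Set

-- Finite subsets and their cardinalities.

⟦_⟧ : {P : Fin n → Set} → Decidable P → Subset n
⟦ P? ⟧ = tabulate (λ x → does (P? x))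

module _ {P : Fin n → Set} (P? : Decidable P) where

  ∈⟦⟧⁺ : ∀ {x} → P x → x ∈ ⟦ P? ⟧
  ∈⟦⟧⁺ {x} px = lookup⇒[]= x _ (trans (lookup∘tabulate _ x) (dec-true (P? x) px))

  ∈⟦⟧⁻ : ∀ {x} → x ∈ ⟦ P? ⟧ → P x
  ∈⟦⟧⁻ {x} x∈ = invert (subst (Reflects (P x)) eq (proof (P? x)))
    where
    eq : does (P? x) ≡ true
    eq = trans (sym (lookup∘tabulate _ x)) ([]=⇒lookup x∈)

-- Induction on `p`: each member uses up its image, which is deleted from `q` before recursing.
-- Injectivity is asked on `p` only, because mates are controlled only inside a paired set.
injection⇒∣∣≤ : (p : Subset m) (q : Subset n) (f : Fin m → Fin n) →
  (∀ {x} → x ∈ p → f x ∈ q) →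
  (∀ {x y} → x ∈ p → y ∈ p → f x ≡ f y → x ≡ y) → ∣ p ∣ ≤ ∣ q ∣
injection⇒∣∣≤ [] q f f∈ inj = z≤n
injection⇒∣∣≤ (outside ∷ p) q f f∈ inj =
  injection⇒∣∣≤ p q (f ∘ suc) (f∈ ∘ there)
    (λ x∈ y∈ eq → Fin.suc-injective (inj (there x∈) (there y∈) eq))
injection⇒∣∣≤ (inside ∷ p) q f f∈ inj =
  ℕ.≤-trans
    (s≤s (injection⇒∣∣≤ p (q - f zero) (f ∘ suc)
      (λ x∈ → x∈p∧x≢y⇒x∈p-y (f∈ (there x∈))
        (λ eq → case inj (there x∈) here eq of λ ()))
      (λ x∈ y∈ eq → Fin.suc-injective (inj (there x∈) (there y∈) eq))))
    (x∈p⇒∣p-x∣<∣p∣ (f∈ here))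

∣∁p∣+∣p∣≡n : (p : Subset n) → ∣ ∁ p ∣ + ∣ p ∣ ≡ n
∣∁p∣+∣p∣≡n p = trans (cong (_+ ∣ p ∣) (∣∁p∣≡n∸∣p∣ p)) (ℕ.m∸n+n≡m (∣p∣≤n p))

∣p∪q∣≤∣p∣+∣q∣ : (p q : Subset n) → ∣ p ∪ q ∣ ≤ ∣ p ∣ + ∣ q ∣
∣p∪q∣≤∣p∣+∣q∣ [] [] = z≤n
∣p∪q∣≤∣p∣+∣q∣ (outside ∷ p) (outside ∷ q) = ∣p∪q∣≤∣p∣+∣q∣ p q
∣p∪q∣≤∣p∣+∣q∣ (outside ∷ p) (inside ∷ q) =
  ℕ.≤-trans (s≤s (∣p∪q∣≤∣p∣+∣q∣ p q)) (ℕ.≤-reflexive (sym (ℕ.+-suc ∣ p ∣ ∣ q ∣)))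
∣p∪q∣≤∣p∣+∣q∣ (inside ∷ p) (outside ∷ q) = s≤s (∣p∪q∣≤∣p∣+∣q∣ p q)
∣p∪q∣≤∣p∣+∣q∣ (inside ∷ p) (inside ∷ q) =
  s≤s (ℕ.≤-trans (∣p∪q∣≤∣p∣+∣q∣ p q) (ℕ.+-monoʳ-≤ ∣ p ∣ (ℕ.n≤1+n _)))

y∉p-y : (p : Subset n) {y : Fin n} → y ∉ p - y
y∉p-y (s ∷ p) {zero} ()
y∉p-y (s ∷ p) {suc y} (there y∈) = y∉p-y p y∈

x∈p-y⁻ : (p : Subset n) {x y : Fin n} → x ∈ p - y → x ∈ p × x ≢ y
x∈p-y⁻ p {x} {y} x∈ = p─q⊆p p ⁅ y ⁆ x∈ , λ { refl → y∉p-y p x∈ }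

∈-minus₂⁺ : ∀ {p : Subset n} {x y z} → x ∈ p → x ≢ y → x ≢ z → x ∈ p - y - z
∈-minus₂⁺ x∈p x≢y x≢z = x∈p∧x≢y⇒x∈p-y (x∈p∧x≢y⇒x∈p-y x∈p x≢y) x≢z

∈-minus₂⁻ : ∀ (p : Subset n) {x y z} → x ∈ p - y - z → x ∈ p × x ≢ y × x ≢ z
∈-minus₂⁻ p {y = y} x∈ with x∈p-y⁻ (p - y) x∈
... | x∈p-y , x≢z with x∈p-y⁻ p x∈p-y
...   | x∈p , x≢y = x∈p , x≢y , x≢z

-- Domination and independence in a simple graph.

module SimpleGraph (G : Graph n) (simple : IsSimple G) where

  infix 4 _~_ _~?_ _≼_

  _~_ : Fin n → Fin n → Set
  _~_ = Adj G

  _~?_ : ∀ u v → Dec (u ~ v)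
  u ~? v = G u v Bool.≟ true

  ~-sym : ∀ {u v} → u ~ v → v ~ u
  ~-sym {u} {v} u~v = trans (sym (proj₁ simple u v)) u~v

  ~-irrefl : ∀ {u} → ¬ u ~ u
  ~-irrefl {u} u~u = case trans (sym u~u) (proj₂ simple u) of λ ()

  ~⇒≢ : ∀ {u v} → u ~ v → u ≢ v
  ~⇒≢ u~v refl = ~-irrefl u~v

  -- Membership of `v` in the closed neighbourhood N[u]; it is not an order relation.
  _≼_ : Fin n → Fin n → Set
  u ≼ v = u ≡ v ⊎ u ~ v

  dominating? : Decidable (Dominating G)
  dominating? D = Fin.all? λ v → (v ∈? D) ⊎-dec Fin.any? λ u → (u ∈? D) ×-dec (u ~? v)

  Dominating-mono : ∀ {S T} → S ⊆ T → Dominating G S → Dominating G T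
  Dominating-mono S⊆T dom v with dom v
  ... | inj₁ v∈S = inj₁ (S⊆T v∈S)
  ... | inj₂ (u , u∈S , u~v) = inj₂ (u , S⊆T u∈S , u~v)

  ≼⇒dominated : ∀ {S u v} → u ∈ S → u ≼ v → v ∈ S ⊎ ∃ λ u → u ∈ S × u ~ v
  ≼⇒dominated u∈S (inj₁ refl) = inj₁ u∈S
  ≼⇒dominated u∈S (inj₂ u~v) = inj₂ (_ , u∈S , u~v)

  dominated⇒≼ : ∀ {S v} → v ∈ S ⊎ (∃ λ u → u ∈ S × u ~ v) → ∃ λ u → u ∈ S × u ≼ v
  dominated⇒≼ (inj₁ v∈S) = _ , v∈S , inj₁ refl
  dominated⇒≼ (inj₂ (u , u∈S , u~v)) = u , u∈S , inj₂ u~v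

  Independent : Subset n → Set
  Independent I = ∀ {u v} → u ∈ I → v ∈ I → ¬ u ~ v

  independentDominating⇒minimal : ∀ {I} → Independent I → Dominating G I → MinimalDominating G I
  independentDominating⇒minimal indep dom = dom , λ where
    S (S⊆I , x , x∈I , x∉S) domS → case domS x of λ where
      (inj₁ x∈S) → x∉S x∈S
      (inj₂ (u , u∈S , u~x)) → indep (S⊆I u∈S) x∈I u~x

  independent-insert : ∀ {I v} → Independent I → (∀ {u} → u ∈ I → ¬ u ~ v) → Independent (I ∪ ⁅ v ⁆)
  independent-insert {I} {v} indep ¬~v {x} {y} x∈ y∈ with x∈p∪q⁻ I ⁅ v ⁆ x∈ | x∈p∪q⁻ I ⁅ v ⁆ y∈
  ... | inj₁ x∈I | inj₁ y∈I = indep x∈I y∈I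
  ... | inj₁ x∈I | inj₂ y∈v rewrite x∈⁅y⁆⇒x≡y v y∈v = ¬~v x∈I
  ... | inj₂ x∈v | inj₁ y∈I rewrite x∈⁅y⁆⇒x≡y v x∈v = ¬~v y∈I ∘ ~-sym
  ... | inj₂ x∈v | inj₂ y∈v rewrite x∈⁅y⁆⇒x≡y v x∈v | x∈⁅y⁆⇒x≡y v y∈v = ~-irrefl

  ⊂-insert : ∀ {I : Subset n} {v} → v ∉ I → I ⊂ I ∪ ⁅ v ⁆
  ⊂-insert {I} {v} v∉I = p⊆p∪q ⁅ v ⁆ , v , q⊆p∪q I ⁅ v ⁆ (x∈⁅x⁆ v) , v∉I

  -- Greedy growth: a vertex not yet dominated is outside `I` and has no neighbour there, so it can
  -- be added. Once nothing is left to add, the set is independent and dominating, hence minimal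
  -- dominating.
  independent-extends : ∀ I → Independent I → ∃ λ J → I ⊆ J × MinimalDominating G J
  independent-extends I = go I (⊃-wellFounded I)
    where
    go : ∀ I → Acc _ I → Independent I → ∃ λ J → I ⊆ J × MinimalDominating G J
    go I (acc rec) indep with dominating? I
    ... | yes dom = I , id , independentDominating⇒minimal indep dom
    ... | no ¬dom with Fin.¬∀⟶∃¬ n _ (λ v → (v ∈? I) ⊎-dec Fin.any? λ u → (u ∈? I) ×-dec (u ~? v)) ¬dom
    ...   | v , ¬v with go (I ∪ ⁅ v ⁆) (rec (⊂-insert (¬v ∘ inj₁)))
                       (independent-insert indep λ u∈I u~v → ¬v (inj₂ (_ , u∈I , u~v)))
    ...     | J , I∪v⊆J , minJ = J , I∪v⊆J ∘ p⊆p∪q ⁅ v ⁆ , minJ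

  independent⇒∣∣≤Γ : ∀ {γ I} → IsUpperDomination G γ → Independent I → ∣ I ∣ ≤ γ
  independent⇒∣∣≤Γ {I = I} (_ , max) indep with independent-extends I indep
  ... | J , I⊆J , minJ = ℕ.≤-trans (p⊆q⇒∣p∣≤∣q∣ I⊆J) (max J minJ)

  ∃minimalDominating⊆ : ∀ D → Dominating G D → ∃ λ S → S ⊆ D × MinimalDominating G S
  ∃minimalDominating⊆ D = go D (⊂-wellFounded D)
    where
    go : ∀ D → Acc _ D → Dominating G D → ∃ λ S → S ⊆ D × MinimalDominating G S
    go D (acc rec) dom with Fin.any? (λ x → (x ∈? D) ×-dec dominating? (D - x))
    ... | yes (x , x∈D , dom-x) with go (D - x) (rec (x∈p⇒p-x⊂p x∈D)) dom-x
    ...   | S , S⊆ , minS = S , p─q⊆p D ⁅ x ⁆ ∘ S⊆ , minS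
    -- Testing single deletions is enough: a smaller dominating `S` omits some `x`, and then `D - x`
    -- contains `S` and dominates too.
    go D (acc rec) dom | no ¬∃ = D , id , dom , λ where
      S (S⊆D , x , x∈D , x∉S) domS →
        ¬∃ (x , x∈D , Dominating-mono (λ u∈S → x∈p∧x≢y⇒x∈p-y (S⊆D u∈S) λ { refl → x∉S u∈S }) domS)

  -- The existence of a private vertex in N[x], in contrapositive form: if the other members of `D`
  -- cover N[x], then `D - x` still dominates.
  minimalDominating⇒irredundant : ∀ {D x} → MinimalDominating G D → x ∈ D →
    ¬ (∀ y → x ≼ y → ∃ λ z → z ∈ D × z ≢ x × z ≼ y)
  minimalDominating⇒irredundant {D} {x} (dom , min) x∈D redundant =
    min (D - x) (x∈p⇒p-x⊂p x∈D) dom-x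
    where
    dom-x : Dominating G (D - x)
    dom-x y with dominated⇒≼ (dom y)
    ... | u , u∈D , u≼y with u Fin.≟ x
    ...   | no u≢x = ≼⇒dominated (x∈p∧x≢y⇒x∈p-y u∈D u≢x) u≼y
    ...   | yes refl with redundant y u≼y
    ...     | z , z∈D , z≢x , z≼y = ≼⇒dominated (x∈p∧x≢y⇒x∈p-y z∈D z≢x) z≼y

  -- Minimal paired dominating sets and the bound Γpr ≤ 2Γ.

  module PairedSet {D} (minD : MinimalPairedDominating G D) where

    dom : Dominating G D
    dom = proj₁ (proj₁ minD)

    mate : Fin n → Fin n
    mate = proj₁ (proj₂ (proj₁ minD))

    private
      matching : ∀ {v} → v ∈ D → (mate v ∈ D) × (mate v ≢ v) × v ~ mate v × (mate (mate v) ≡ v)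
      matching {v} = proj₂ (proj₂ (proj₁ minD)) v

    mate∈ : ∀ {v} → v ∈ D → mate v ∈ D
    mate∈ = proj₁ ∘ matching

    mate≢ : ∀ {v} → v ∈ D → mate v ≢ v
    mate≢ = proj₁ ∘ proj₂ ∘ matching

    ~mate : ∀ {v} → v ∈ D → v ~ mate v
    ~mate = proj₁ ∘ proj₂ ∘ proj₂ ∘ matching

    mate² : ∀ {v} → v ∈ D → mate (mate v) ≡ v
    mate² = proj₂ ∘ proj₂ ∘ proj₂ ∘ matching

    mate-inj : ∀ {u v} → u ∈ D → v ∈ D → mate u ≡ mate v → u ≡ v
    mate-inj u∈ v∈ eq = trans (sym (mate² u∈)) (trans (cong mate eq) (mate² v∈))

    mate-flip : ∀ {u v} → u ∈ D → mate u ≡ v → u ≡ mate v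
    mate-flip u∈ refl = sym (mate² u∈)

    -- Deleting a whole matched pair leaves the rest perfectly matched by the same `mate`, so
    -- domination is what must fail.
    ¬dominating-minus-pair : ∀ {v} → v ∈ D → ¬ Dominating G (D - v - mate v)
    ¬dominating-minus-pair {v} v∈D dom′ =
      proj₂ minD (D - v - mate v)
        (proj₁ ∘ ∈-minus₂⁻ D , v , v∈D , λ v∈ → proj₁ (proj₂ (∈-minus₂⁻ D v∈)) refl)
        (dom′ , mate , λ u u∈ → case ∈-minus₂⁻ D u∈ of λ where
          (u∈D , u≢v , u≢v′) →
            ∈-minus₂⁺ (mate∈ u∈D) (u≢v′ ∘ mate-flip u∈D) (u≢v ∘ mate-inj u∈D v∈D)
            , mate≢ u∈D , ~mate u∈D , mate² u∈D)

  -- `mate` sends the members of `D` outside `S` injectively into `S`. A pair missed entirely by `S`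
  -- could be deleted from `D`, since the remainder would contain `S` and so dominate.
  Γpr≤2Γ : ∀ {γ γpr} → IsUpperDomination G γ → IsUpperPairedDomination G γpr → γpr ≤ 2 * γ
  Γpr≤2Γ {γ} (_ , max) ((D , minD , refl) , _) with ∃minimalDominating⊆ D (proj₁ (proj₁ minD))
  ... | S , S⊆D , minS = begin
    ∣ D ∣                    ≤⟨ p⊆q⇒∣p∣≤∣q∣ D⊆ ⟩
    ∣ S ∪ ⟦ rest? ⟧ ∣        ≤⟨ ∣p∪q∣≤∣p∣+∣q∣ S ⟦ rest? ⟧ ⟩
    ∣ S ∣ + ∣ ⟦ rest? ⟧ ∣    ≤⟨ ℕ.+-monoʳ-≤ ∣ S ∣ (injection⇒∣∣≤ ⟦ rest? ⟧ S mate mate∈S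
                                 (λ x∈ y∈ → mate-inj (proj₁ (∈⟦⟧⁻ rest? x∈)) (proj₁ (∈⟦⟧⁻ rest? y∈)))) ⟩
    ∣ S ∣ + ∣ S ∣            ≤⟨ ℕ.+-mono-≤ (max S minS) (max S minS) ⟩
    γ + γ                    ≡⟨ cong (γ +_) (sym (ℕ.+-identityʳ γ)) ⟩
    2 * γ                    ∎
    where
    open ℕ.≤-Reasoning
    open PairedSet minD
    rest? : Decidable (λ x → x ∈ D × x ∉ S)
    rest? x = (x ∈? D) ×-dec ¬? (x ∈? S)
    D⊆ : D ⊆ S ∪ ⟦ rest? ⟧
    D⊆ {x} x∈D with x ∈? S
    ... | yes x∈S = x∈p∪q⁺ (inj₁ x∈S)
    ... | no x∉S = x∈p∪q⁺ (inj₂ (∈⟦⟧⁺ rest? (x∈D , x∉S)))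
    mate∈S : ∀ {x} → x ∈ ⟦ rest? ⟧ → mate x ∈ S
    mate∈S {x} x∈ with ∈⟦⟧⁻ rest? x∈ | mate x ∈? S
    ... | _ | yes mx∈S = mx∈S
    ... | x∈D , x∉S | no mx∉S = contradiction
      (Dominating-mono
        (λ u∈S → ∈-minus₂⁺ (S⊆D u∈S) (λ { refl → x∉S u∈S }) λ { refl → mx∉S u∈S }) (proj₁ minS))
      (¬dominating-minus-pair x∈D)

-- Paths and cycles as lists.

∈pairs⁻ : ∀ (l : List A) {u v} → (u , v) List.∈ pairs l → u List.∈ l × v List.∈ l
∈pairs⁻ (a ∷ b ∷ l) (here refl) = here refl , there (here refl)
∈pairs⁻ (a ∷ b ∷ l) (there e∈) with ∈pairs⁻ (b ∷ l) e∈
... | u∈ , v∈ = there u∈ , there v∈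

∈cycEdges⁻ : ∀ (l : List A) {u v} → (u , v) List.∈ cycEdges l → u List.∈ l × v List.∈ l
∈cycEdges⁻ (x ∷ xs) e∈ with ∈pairs⁻ (x ∷ xs ++ [ x ]) e∈
... | u∈ , v∈ = drop u∈ , drop v∈
  where
  drop : ∀ {u} → u List.∈ (x ∷ xs ++ [ x ]) → u List.∈ (x ∷ xs)
  drop u∈ with ∈-++⁻ (x ∷ xs) u∈
  ... | inj₁ u∈l = u∈l
  ... | inj₂ (here refl) = here refl

cycleEdge⇒∈ : ∀ {l : List (Fin n)} {u v} → CycleEdge l u v → u List.∈ l
cycleEdge⇒∈ {l = l} (inj₁ e∈) = proj₁ (∈cycEdges⁻ l e∈)
cycleEdge⇒∈ {l = l} (inj₂ e∈) = proj₂ (∈cycEdges⁻ l e∈)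

pairs-prefix : ∀ (l : List A) {u r} → All P (pairs (l ++ u ∷ r)) → All P (pairs (l ++ [ u ]))
pairs-prefix [] _ = []
pairs-prefix (a ∷ []) (p ∷ _) = p ∷ []
pairs-prefix (a ∷ b ∷ l) (p ∷ ps) = p ∷ pairs-prefix (b ∷ l) ps

pairs-pred : ∀ a (l : List A) {u r} → All P (pairs (a ∷ l ++ u ∷ r)) →
  ∃ λ p → p List.∈ (a ∷ l) × P (p , u)
pairs-pred a [] (p ∷ _) = a , here refl , p
pairs-pred a (b ∷ l) (_ ∷ ps) with pairs-pred b l ps
... | p , p∈ , Ppu = p , there p∈ , Ppu

pairs-succ : ∀ (l : List A) {u v r} → All P (pairs (l ++ u ∷ v ∷ r)) → P (u , v)
pairs-succ [] (p ∷ _) = p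
pairs-succ (a ∷ []) (_ ∷ ps) = pairs-succ [] ps
pairs-succ (a ∷ b ∷ l) (_ ∷ ps) = pairs-succ (b ∷ l) ps

unique-prefix : ∀ (l : List A) {u r} → Unique (l ++ u ∷ r) → Unique (u ∷ l)
unique-prefix [] _ = [] ∷ []
unique-prefix (a ∷ l) {u} (a∉ ∷ uniq) with unique-prefix l uniq
... | u∉l ∷ uniq-l =
  (≢-sym (All.lookup (All.++⁻ʳ l a∉) (here refl)) ∷ u∉l) ∷ All.++⁻ˡ l a∉ ∷ uniq-l

unique-apart : ∀ (l : List A) {r u v} → Unique (l ++ r) → u List.∈ l → v List.∈ r → u ≢ v
unique-apart (a ∷ l) (a∉ ∷ _) (here refl) v∈ = All.lookup (All.++⁻ʳ l a∉) v∈
unique-apart (a ∷ l) (_ ∷ uniq) (there u∈) v∈ = unique-apart l uniq u∈ v∈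

lookup-injective : ∀ {l : List A} → Unique l → ∀ {i j} → lookup l i ≡ lookup l j → i ≡ j
lookup-injective (_ ∷ _) {zero} {zero} _ = refl
lookup-injective (a∉ ∷ _) {zero} {suc j} eq = contradiction eq (All.lookup a∉ (∈-lookup j))
lookup-injective (a∉ ∷ _) {suc i} {zero} eq = contradiction (sym eq) (All.lookup a∉ (∈-lookup i))
lookup-injective (_ ∷ uniq) {suc i} {suc j} eq = cong suc (lookup-injective uniq eq)

unique⇒length≤ : ∀ {l : List (Fin n)} → Unique l → length l ≤ n
unique⇒length≤ uniq = Fin.injective⇒≤ (lookup-injective uniq)

-- Cycles, forests and large independent sets.

module Cycles (G : Graph n) (simple : IsSimple G) where
  open SimpleGraph G simple

  -- For `y` in `X` this says that `y` has degree at least two in the subgraph induced by `X`.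
  TwoNeighboursIn : (Fin n → Set) → Fin n → Set
  TwoNeighboursIn X y = ∃₂ λ x z → x ≢ z × X x × X z × y ~ x × y ~ z

  -- The two neighbours are the cyclic predecessor and successor of `y`; they are distinct because
  -- the list is duplicate-free and has at least three entries. The cases are `y` at the head, at
  -- the end, and in between.
  cycle⇒twoNeighbours : ∀ {c y} → IsCycle G c → y List.∈ c → TwoNeighboursIn (List._∈ c) y
  cycle⇒twoNeighbours {x ∷ b ∷ c ∷ r} (_ , (_ ∷ b∉ ∷ _) , x~b ∷ _ ∷ es) (here refl)
    with pairs-pred c r es
  ... | p , p∈ , p~x =
    b , p , All.lookup b∉ p∈ , there (here refl) , there (there p∈) , x~b , ~-sym p~x
  cycle⇒twoNeighbours {_ ∷ []} (s≤s () , _) (here refl)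
  cycle⇒twoNeighbours {_ ∷ _ ∷ []} (s≤s (s≤s ()) , _) (here refl)
  cycle⇒twoNeighbours {x ∷ xs} {y} (len , uniq , es) (there y∈) with ∈-∃++ y∈
  ... | ys , zs , refl = interior ys zs len uniq
        (subst (λ l → All (uncurry _~_) (pairs (x ∷ l))) (++-assoc ys (y ∷ zs) [ x ]) es)
    where
    interior : ∀ ys zs → 3 ≤ length (x ∷ ys ++ y ∷ zs) → Unique (x ∷ ys ++ y ∷ zs) →
      All (uncurry _~_) (pairs (x ∷ ys ++ y ∷ zs ++ [ x ])) →
      TwoNeighboursIn (List._∈ (x ∷ ys ++ y ∷ zs)) y
    interior [] [] (s≤s (s≤s ())) uniq es
    interior (a ∷ l) [] len (x∉ ∷ uniq) (_ ∷ es) with pairs-pred a l es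
    ... | p , p∈ , p~y = x , p , All.lookup x∉ (∈-++⁺ˡ p∈) , here refl , there (∈-++⁺ˡ p∈)
          , pairs-succ (a ∷ l) es , ~-sym p~y
    interior ys (z ∷ zs) len uniq es with pairs-pred x ys es
    ... | p , p∈ , p~y = p , z , unique-apart (x ∷ ys) uniq p∈ (there (here refl))
          , ∈-++⁺ˡ p∈ , ∈-++⁺ʳ (x ∷ ys) (there (here refl)) , ~-sym p~y , pairs-succ (x ∷ ys) es

  -- Walk inside `S` without turning back: the current vertex always has a neighbour in `S` other
  -- than its predecessor. The walk must revisit a vertex, as a path has at most `n` vertices.
  ∃cycle-within : ∀ S → Nonempty S → (∀ {v} → v ∈ S → TwoNeighboursIn (_∈ S) v) →
    ∃ λ c → IsCycle G c × All (_∈ S) c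
  ∃cycle-within S (v , v∈S) two with two v∈S
  ... | w , _ , _ , w∈S , _ , v~w , _ =
    -- The path is stored latest vertex first. The first argument of `grow` is fuel: it plus the
    -- path length always exceeds `n`, so running out contradicts the length bound on duplicate-free
    -- lists.
    grow n w v [] ((≢-sym (~⇒≢ v~w) ∷ []) ∷ [] ∷ []) (w∈S ∷ v∈S ∷ []) (~-sym v~w ∷ [])
      (ℕ.≤-reflexive (ℕ.+-comm 1 n))
    where
    open import Data.List.Membership.DecPropositional (Fin._≟_ {n}) using () renaming (_∈?_ to _∈L?_)

    -- Any repetition u closes the part of the path before it.
    close : ∀ {u v w vs} → u ~ v → u ≢ w → Unique (v ∷ w ∷ vs) → All (_∈ S) (v ∷ w ∷ vs) →
      All (uncurry _~_) (pairs (v ∷ w ∷ vs)) → u ∈ S → u List.∈ (v ∷ w ∷ vs) →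
      ∃ λ c → IsCycle G c × All (_∈ S) c
    close u~v u≢w uniq ⊆S path u∈S u∈ with ∈-∃++ u∈
    ... | [] , _ , refl = contradiction u~v ~-irrefl
    ... | _ ∷ [] , _ , refl = contradiction refl u≢w
    ... | v ∷ w ∷ l , _ , refl =
      _ ∷ v ∷ w ∷ l
      , (s≤s (s≤s (s≤s z≤n)) , unique-prefix (v ∷ w ∷ l) uniq , u~v ∷ pairs-prefix (v ∷ w ∷ l) path)
      , u∈S ∷ All.++⁻ˡ (v ∷ w ∷ l) ⊆S

    grow : ∀ k v w vs → Unique (v ∷ w ∷ vs) → All (_∈ S) (v ∷ w ∷ vs) →
      All (uncurry _~_) (pairs (v ∷ w ∷ vs)) → n < k + suc (length vs) →
      ∃ λ c → IsCycle G c × All (_∈ S) c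
    grow zero v w vs uniq ⊆S path n< =
      contradiction (ℕ.≤-trans (ℕ.n≤1+n _) (unique⇒length≤ uniq)) (ℕ.<⇒≱ n<)
    grow (suc k) v w vs uniq ⊆S@(v∈S ∷ _) path n< with two v∈S
    ... | x , z , x≢z , x∈S , z∈S , v~x , v~z = case x Fin.≟ w of λ where
        (no x≢w) → step x x∈S v~x x≢w
        (yes refl) → step z z∈S v~z (≢-sym x≢z)
      where
      step : ∀ u → u ∈ S → v ~ u → u ≢ w → ∃ λ c → IsCycle G c × All (_∈ S) c
      step u u∈S v~u u≢w with u ∈L? (v ∷ w ∷ vs)
      ... | yes u∈ = close (~-sym v~u) u≢w uniq ⊆S path u∈S u∈
      ... | no u∉ = grow k u v (w ∷ vs) (All.¬Any⇒All¬ _ u∉ ∷ uniq) (u∈S ∷ ⊆S) (~-sym v~u ∷ path)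
                      (ℕ.≤-trans n< (ℕ.≤-reflexive (sym (ℕ.+-suc k _))))

  -- By `∃cycle-within`, a nonempty acyclic `S` has a vertex `v` with at most one neighbour `u` in
  -- `S`. Put `v` into `I` and recurse on `S - v - u`: at most two vertices are lost for one gained.
  acyclic⇒∃independent : ∀ S → (∀ c → IsCycle G c → ¬ All (_∈ S) c) →
    ∃ λ I → I ⊆ S × Independent I × ∣ S ∣ ≤ 2 * ∣ I ∣
  acyclic⇒∃independent S = go S (⊂-wellFounded S)
    where
    two? : ∀ S → Decidable (TwoNeighboursIn (_∈ S))
    two? S y = Fin.any? λ x → Fin.any? λ z →
      ¬? (x Fin.≟ z) ×-dec (x ∈? S) ×-dec (z ∈? S) ×-dec (y ~? x) ×-dec (y ~? z)

    remove : ∀ S v u → v ∈ S → (∀ w → w ∈ S → v ~ w → w ≡ u) →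
      (∃ λ I → I ⊆ (S - v - u) × Independent I × ∣ S - v - u ∣ ≤ 2 * ∣ I ∣) →
      ∃ λ I → I ⊆ S × Independent I × ∣ S ∣ ≤ 2 * ∣ I ∣
    remove S v u v∈S uniq-nbr (I , I⊆ , indep , S≤) =
      I ∪ ⁅ v ⁆ , I∪v⊆S , independent-insert indep ¬~v , (begin
        ∣ S ∣                              ≤⟨ p⊆q⇒∣p∣≤∣q∣ S⊆ ⟩
        ∣ (⁅ v ⁆ ∪ ⁅ u ⁆) ∪ (S - v - u) ∣  ≤⟨ ∣p∪q∣≤∣p∣+∣q∣ (⁅ v ⁆ ∪ ⁅ u ⁆) (S - v - u) ⟩
        ∣ ⁅ v ⁆ ∪ ⁅ u ⁆ ∣ + ∣ S - v - u ∣  ≤⟨ ℕ.+-mono-≤ (∣p∪q∣≤∣p∣+∣q∣ ⁅ v ⁆ ⁅ u ⁆) S≤ ⟩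
        ∣ ⁅ v ⁆ ∣ + ∣ ⁅ u ⁆ ∣ + 2 * ∣ I ∣   ≡⟨ cong (_+ 2 * ∣ I ∣) (cong₂ _+_ (∣⁅x⁆∣≡1 v) (∣⁅x⁆∣≡1 u)) ⟩
        2 + 2 * ∣ I ∣                      ≡⟨ sym (ℕ.*-suc 2 ∣ I ∣) ⟩
        2 * suc ∣ I ∣                      ≤⟨ ℕ.*-monoʳ-≤ 2 (p⊂q⇒∣p∣<∣q∣ (⊂-insert v∉I)) ⟩
        2 * ∣ I ∪ ⁅ v ⁆ ∣                  ∎)
      where
      open ℕ.≤-Reasoning
      I⊆S : I ⊆ S
      I⊆S = p─q⊆p S ⁅ v ⁆ ∘ p─q⊆p (S - v) ⁅ u ⁆ ∘ I⊆
      v∉I : v ∉ I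
      v∉I = y∉p-y S ∘ p─q⊆p (S - v) ⁅ u ⁆ ∘ I⊆
      ¬~v : ∀ {w} → w ∈ I → ¬ w ~ v
      ¬~v w∈I w~v = proj₂ (x∈p-y⁻ (S - v) (I⊆ w∈I)) (uniq-nbr _ (I⊆S w∈I) (~-sym w~v))
      I∪v⊆S : I ∪ ⁅ v ⁆ ⊆ S
      I∪v⊆S x∈ with x∈p∪q⁻ I ⁅ v ⁆ x∈
      ... | inj₁ x∈I = I⊆S x∈I
      ... | inj₂ x∈v rewrite x∈⁅y⁆⇒x≡y v x∈v = v∈S
      S⊆ : S ⊆ (⁅ v ⁆ ∪ ⁅ u ⁆) ∪ (S - v - u)
      S⊆ {x} x∈S with x Fin.≟ v | x Fin.≟ u
      ... | yes refl | _ = x∈p∪q⁺ (inj₁ (x∈p∪q⁺ (inj₁ (x∈⁅x⁆ x))))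
      ... | no _ | yes refl = x∈p∪q⁺ (inj₁ (x∈p∪q⁺ (inj₂ (x∈⁅x⁆ x))))
      ... | no x≢v | no x≢u = x∈p∪q⁺ {p = ⁅ v ⁆ ∪ ⁅ u ⁆} (inj₂ (∈-minus₂⁺ x∈S x≢v x≢u))

    go : ∀ S → Acc _⊂_ S → (∀ c → IsCycle G c → ¬ All (_∈ S) c) →
      ∃ λ I → I ⊆ S × Independent I × ∣ S ∣ ≤ 2 * ∣ I ∣
    go S (acc rec) acyclic with Fin.any? (λ v → (v ∈? S) ×-dec ¬? (two? S v))
    go S (acc rec) acyclic | no none = ⊥ , ⊥⊆ , (λ x∈ → contradiction x∈ ∉⊥) , ∣S∣≤
      where
      empty : Empty S
      empty ne with ∃cycle-within S ne (λ {v} v∈S → decidable-stable (two? S v) λ ¬two → none (v , v∈S , ¬two))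
      ... | c , cyc , ⊆S = acyclic c cyc ⊆S
      ∣S∣≤ : ∣ S ∣ ≤ 2 * ∣ ⊥ {n} ∣
      ∣S∣≤ rewrite Empty-unique empty | ∣⊥∣≡0 n = z≤n
    go S (acc rec) acyclic | yes (v , v∈S , ¬two) with Fin.any? (λ u → (u ∈? S) ×-dec (v ~? u))
    ... | yes (u , u∈S , v~u) =
      remove S v u v∈S (λ w w∈S v~w → decidable-stable (w Fin.≟ u) λ w≢u →
        ¬two (w , u , w≢u , w∈S , u∈S , v~w , v~u)) (go (S - v - u)
        (rec (⊆-⊂-trans (p─q⊆p (S - v) ⁅ u ⁆) (x∈p⇒p-x⊂p v∈S)))
        (λ c cyc ⊆S′ → acyclic c cyc (All.map (p─q⊆p S ⁅ v ⁆ ∘ p─q⊆p (S - v) ⁅ u ⁆) ⊆S′)))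
    ... | no none =
      -- An isolated `v` takes itself as `u`: the condition on its neighbours is vacuous and the
      -- second deletion changes nothing.
      remove S v v v∈S (λ w w∈S v~w → contradiction (w , w∈S , v~w) none) (go (S - v - v)
        (rec (⊆-⊂-trans (p─q⊆p (S - v) ⁅ v ⁆) (x∈p⇒p-x⊂p v∈S)))
        (λ c cyc ⊆S′ → acyclic c cyc (All.map (p─q⊆p S ⁅ v ⁆ ∘ p─q⊆p (S - v) ⁅ v ⁆) ⊆S′)))

  cycle⇒edge : ∀ {c} → IsCycle G c → ∃₂ λ x y → CycleEdge c x y
  cycle⇒edge {x ∷ y ∷ c} _ = x , y , inj₁ (here refl)
  cycle⇒edge {_ ∷ []} (s≤s () , _)
  cycle⇒edge {[]} (() , _)

  unicyclic⇒n≤1+2Γ : ∀ {γ} → Unicyclic G → IsUpperDomination G γ → n ≤ suc (2 * γ)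
  unicyclic⇒n≤1+2Γ {γ} (_ , (c , cyc) , unique) maxΓ with cycle⇒edge cyc
  ... | x , y , xy∈c with acyclic⇒∃independent (∁ ⁅ x ⁆) acyclic
    where
    acyclic : ∀ c′ → IsCycle G c′ → ¬ All (_∈ ∁ ⁅ x ⁆) c′
    -- By uniqueness every cycle has the same edges as `c`, so it uses the edge from `x` to `y` and
    -- passes through `x`.
    acyclic c′ cyc′ avoid = x∈∁p⇒x∉p
      (All.lookup avoid (cycleEdge⇒∈ (Equivalence.to (unique c c′ cyc cyc′ x y) xy∈c))) (x∈⁅x⁆ x)
  ... | I , _ , indep , ∁x≤ = begin
    n                        ≡⟨ sym (∣∁p∣+∣p∣≡n ⁅ x ⁆) ⟩
    ∣ ∁ ⁅ x ⁆ ∣ + ∣ ⁅ x ⁆ ∣  ≡⟨ cong (∣ ∁ ⁅ x ⁆ ∣ +_) (∣⁅x⁆∣≡1 x) ⟩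
    ∣ ∁ ⁅ x ⁆ ∣ + 1          ≡⟨ ℕ.+-comm _ 1 ⟩
    suc ∣ ∁ ⁅ x ⁆ ∣          ≤⟨ s≤s ∁x≤ ⟩
    suc (2 * ∣ I ∣)          ≤⟨ s≤s (ℕ.*-monoʳ-≤ 2 (independent⇒∣∣≤Γ maxΓ indep)) ⟩
    suc (2 * γ)              ∎
    where open ℕ.≤-Reasoning

-- Graphs presented by named vertices, and the spider.

record Model {n} (G : Graph n) {V : Set} (E : V → V → Set) : Set where
  field
    vertex     : V → Fin n
    injective  : ∀ {x y} → vertex x ≡ vertex y → x ≡ y
    surjective : ∀ u → ∃ λ x → vertex x ≡ u
    adj⇔       : ∀ x y → Adj G (vertex x) (vertex y) ⇔ E x y

  code : Fin n → V
  code u = proj₁ (surjective u)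

  vertex-code : ∀ u → vertex (code u) ≡ u
  vertex-code u = proj₂ (surjective u)

  code-vertex : ∀ x → code (vertex x) ≡ x
  code-vertex x = injective (vertex-code (vertex x))

  code-adj⇔ : ∀ u v → Adj G u v ⇔ E (code u) (code v)
  code-adj⇔ u v = subst₂ (λ u′ v′ → Adj G u′ v′ ⇔ E (code u) (code v))
    (vertex-code u) (vertex-code v) (adj⇔ (code u) (code v))

-- Encode by one model and decode by the other. This lets an unknown graph and a concrete one be
-- compared separately with the same named vertices.
models⇒≅ : ∀ {n m V} {G : Graph n} {H : Graph m} {E : V → V → Set} → Model G E → Model H E → G ≅ H
models⇒≅ M N =
  mk↔ₛ′ (N.vertex ∘ M.code) (M.vertex ∘ N.code)
    (λ u → trans (cong N.vertex (M.code-vertex (N.code u))) (N.vertex-code u))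
    (λ u → trans (cong M.vertex (N.code-vertex (M.code u))) (M.vertex-code u))
  , λ u v → ⇔-trans (M.code-adj⇔ u v) (⇔-sym (N.adj⇔ (M.code u) (M.code v)))
  where
  module M = Model M
  module N = Model N

≅⇒model : ∀ {n m V} {G : Graph n} {H : Graph m} {E : V → V → Set} → G ≅ H → Model H E → Model G E
≅⇒model {H = H} {E = E} (φ , φ-adj) N = record
  { vertex = φ.from ∘ N.vertex
  ; injective = λ eq → N.injective (trans (sym (φ.strictlyInverseˡ _)) (trans (cong φ.to eq) (φ.strictlyInverseˡ _)))
  ; surjective = λ u → N.code (φ.to u) , trans (cong φ.from (N.vertex-code (φ.to u))) (φ.strictlyInverseʳ u)
  ; adj⇔ = λ x y → ⇔-trans (φ-adj _ _) (subst₂ (λ u v → Adj H u v ⇔ E x y)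
      (sym (φ.strictlyInverseˡ (N.vertex x))) (sym (φ.strictlyInverseˡ (N.vertex y))) (N.adj⇔ x y))
  }
  where
  module φ = Inverse φ
  module N = Model N

self-model : ∀ {n} (G : Graph n) → Model G (Adj G)
self-model G = record
  { vertex = id ; injective = id ; surjective = λ u → u , refl ; adj⇔ = λ _ _ → mk⇔ id id }

-- The vertices of K_{1,t}^{*1}: `hub` is the centre, `triˡ` and `triʳ` complete the triangle, each
-- `foot` subdivides a ray and each `tip` is its leaf.
data Spider (t : ℕ) : Set where
  hub triˡ triʳ : Spider t
  foot tip      : Fin t → Spider t

-- The perfect matching of the spider without its centre; the value at `hub` is a default that keeps
-- the map an involution.
partner : ∀ {t} → Spider t → Spider t
partner hub      = hub
partner triˡ     = triʳ
partner triʳ     = triˡ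
partner (foot i) = tip i
partner (tip i)  = foot i

hub? : ∀ {t} (x : Spider t) → Dec (x ≡ hub)
hub? hub      = yes refl
hub? triˡ     = no λ ()
hub? triʳ     = no λ ()
hub? (foot _) = no λ ()
hub? (tip _)  = no λ ()

-- All edges away from the centre are matching edges, so `pair` covers them in both directions. Its
-- premise excludes the loop that `partner hub` would give.
data SpiderEdge {t : ℕ} : Spider t → Spider t → Set where
  hub-triˡ : SpiderEdge hub triˡ
  triˡ-hub : SpiderEdge triˡ hub
  hub-triʳ : SpiderEdge hub triʳ
  triʳ-hub : SpiderEdge triʳ hub
  hub-foot : ∀ i → SpiderEdge hub (foot i)
  foot-hub : ∀ i → SpiderEdge (foot i) hub
  pair     : ∀ {x} → x ≢ hub → SpiderEdge x (partner x)

-- The form in which connectedness is used: a property closed under adjacency and true somewhere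
-- holds everywhere.
Star-closed : ∀ {A : Set} {R : A → A → Set} (P : A → Set) → (∀ {x y} → P x → R x y → P y) →
  ∀ {x y} → Star R x y → P x → P y
Star-closed P closed ε px = px
Star-closed P closed (r ◅ rs) px = Star-closed P closed rs (closed px r)

-- Forward direction: the structure of `G` when Γpr = 2Γ.

module Forward {n} (G : Graph n) (simple : IsSimple G) (unicyclic : Unicyclic G)
  {D : Subset n} (minD : MinimalPairedDominating G D) where

  open SimpleGraph G simple
  open Cycles G simple
  open PairedSet minD

  -- Otherwise s and s′ could be matched with each other, and their mates dropped from D.
  crossEdge⇒undominated : ∀ {s s′} → s ∈ D → s′ ∈ D → s ~ s′ → s′ ≢ mate s →
    ∃ λ c → c ∉ D × (∀ u → u ∈ D → u ~ c → u ≡ mate s ⊎ u ≡ mate s′)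
  crossEdge⇒undominated {s} {s′} s∈D s′∈D s~s′ s′≢ with dominating? (D - mate s - mate s′)
  ... | yes domD′ = contradiction (domD′ , rematch , rematched)
      (proj₂ minD D′ (proj₁ ∘ D′⁻ , mate s , mate∈ s∈D , λ ∈D′ → proj₁ (proj₂ (D′⁻ ∈D′)) refl))
    where
    D′ : Subset n
    D′ = D - mate s - mate s′
    D′⁻ : ∀ {u} → u ∈ D′ → u ∈ D × u ≢ mate s × u ≢ mate s′
    D′⁻ = ∈-minus₂⁻ D
    s≢q : s ≢ mate s′
    s≢q eq = s′≢ (mate-flip s′∈D (sym eq))
    s∈D′ : s ∈ D′
    s∈D′ = ∈-minus₂⁺ s∈D (≢-sym (mate≢ s∈D)) s≢q
    s′∈D′ : s′ ∈ D′
    s′∈D′ = ∈-minus₂⁺ s′∈D s′≢ (≢-sym (mate≢ s′∈D))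
    rematch : Fin n → Fin n
    rematch v with v Fin.≟ s | v Fin.≟ s′
    ... | yes _ | _     = s′
    ... | no _  | yes _ = s
    ... | no _  | no _  = mate v
    rematch-s : rematch s ≡ s′
    rematch-s with s Fin.≟ s
    ... | yes _ = refl
    ... | no ¬eq = contradiction refl ¬eq
    rematch-s′ : rematch s′ ≡ s
    rematch-s′ with s′ Fin.≟ s | s′ Fin.≟ s′
    ... | yes eq | _ = contradiction (sym eq) (~⇒≢ s~s′)
    ... | no _ | yes _ = refl
    ... | no _ | no ¬eq = contradiction refl ¬eq
    rematch-other : ∀ {v} → v ≢ s → v ≢ s′ → rematch v ≡ mate v
    rematch-other {v} v≢s v≢s′ with v Fin.≟ s | v Fin.≟ s′
    ... | yes eq | _ = contradiction eq v≢s
    ... | no _ | yes eq = contradiction eq v≢s′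
    ... | no _ | no _ = refl
    rematched : ∀ v → v ∈ D′ → (rematch v ∈ D′) × (rematch v ≢ v) × v ~ rematch v × (rematch (rematch v) ≡ v)
    rematched v v∈ with v Fin.≟ s | v Fin.≟ s′
    ... | yes refl | _ = s′∈D′ , ≢-sym (~⇒≢ s~s′) , s~s′ , rematch-s′
    ... | no _ | yes refl = s∈D′ , ~⇒≢ s~s′ , ~-sym s~s′ , rematch-s
    ... | no v≢s | no v≢s′ with D′⁻ v∈
    ...   | v∈D , v≢p , v≢q =
      ∈-minus₂⁺ (mate∈ v∈D) (v≢s ∘ mate-inj v∈D s∈D) (v≢s′ ∘ mate-inj v∈D s′∈D)
      , mate≢ v∈D , ~mate v∈D
      , trans (rematch-other (v≢p ∘ mate-flip v∈D) (v≢q ∘ mate-flip v∈D)) (mate² v∈D)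
  ... | no ¬dom with Fin.¬∀⟶∃¬ n _ (λ v → (v ∈? _) ⊎-dec Fin.any? λ u → (u ∈? _) ×-dec (u ~? v)) ¬dom
  ...   | c , ¬c = c , c∉D , λ u u∈D u~c → outside⇒mate u∈D λ u∈D′ → ¬c (inj₂ (u , u∈D′ , u~c))
    where
    outside⇒mate : ∀ {u} → u ∈ D → u ∉ D - mate s - mate s′ → u ≡ mate s ⊎ u ≡ mate s′
    outside⇒mate {u} u∈D u∉ with u Fin.≟ mate s | u Fin.≟ mate s′
    ... | yes eq | _ = inj₁ eq
    ... | no _ | yes eq = inj₂ eq
    ... | no u≢p | no u≢q = contradiction (∈-minus₂⁺ u∈D u≢p u≢q) u∉
    s∈D′ : s ∈ D - mate s - mate s′
    s∈D′ = ∈-minus₂⁺ s∈D (≢-sym (mate≢ s∈D))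
      λ eq → s′≢ (mate-flip s′∈D (sym eq))
    s′∈D′ : s′ ∈ D - mate s - mate s′
    s′∈D′ = ∈-minus₂⁺ s′∈D s′≢ (≢-sym (mate≢ s′∈D))
    c∉D : c ∉ D
    -- A member of `D` outside the reduced set is one of the two dropped mates, and these are still
    -- dominated by `s` and `s′`.
    c∉D c∈D with outside⇒mate c∈D (¬c ∘ inj₁)
    ... | inj₁ refl = ¬c (inj₂ (s , s∈D′ , ~mate s∈D))
    ... | inj₂ refl = ¬c (inj₂ (s′ , s′∈D′ , ~mate s′∈D))

  cyc : List (Fin n)
  cyc = proj₁ (proj₁ (proj₂ unicyclic))

  isCycle : IsCycle G cyc
  isCycle = proj₂ (proj₁ (proj₂ unicyclic))

  -- A cycle vertex has two neighbours, one of which is not its mate. That gives a cross edge, and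
  -- with it a vertex outside `D`.
  full⇒⊥ : ¬ (∀ v → v ∈ D)
  full⇒⊥ all∈D with cycle⇒edge isCycle
  ... | y , _ , ye with cycle⇒twoNeighbours isCycle (cycleEdge⇒∈ ye)
  ...   | x , z , x≢z , _ , _ , y~x , y~z with x Fin.≟ mate y
  ...     | no x≢ with crossEdge⇒undominated (all∈D y) (all∈D x) y~x x≢
  ...       | c , c∉D , _ = c∉D (all∈D c)
  full⇒⊥ all∈D | y , _ , ye | x , z , x≢z , _ , _ , y~x , y~z | yes refl
    with crossEdge⇒undominated (all∈D y) (all∈D z) y~z (≢-sym x≢z)
  ... | c , c∉D , _ = c∉D (all∈D c)

  -- The case where `D` misses exactly the vertex `c`.

  module AllButOne (c : Fin n) (c∉D : c ∉ D) (≢c⇒∈D : ∀ {v} → v ≢ c → v ∈ D) where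

    ∈D⇒≢c : ∀ {v} → v ∈ D → v ≢ c
    ∈D⇒≢c v∈D refl = c∉D v∈D

    mate≢c : ∀ {v} → v ≢ c → mate v ≢ c
    mate≢c = ∈D⇒≢c ∘ mate∈ ∘ ≢c⇒∈D

    Cross : Fin n → Fin n → Set
    Cross x y = x ≢ c × y ≢ c × x ~ y × y ≢ mate x

    cross? : ∀ x y → Dec (Cross x y)
    cross? x y = ¬? (x Fin.≟ c) ×-dec ¬? (y Fin.≟ c) ×-dec (x ~? y) ×-dec ¬? (y Fin.≟ mate x)

    Cross-sym : ∀ {x y} → Cross x y → Cross y x
    Cross-sym (x≢c , y≢c , x~y , y≢) = y≢c , x≢c , ~-sym x~y , λ x≡ → y≢ (mate-flip (≢c⇒∈D y≢c) (sym x≡))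

    -- The vertex outside `D` supplied by `crossEdge⇒undominated` can only be `c`.
    cross⇒N[c] : ∀ {x y u} → Cross x y → u ~ c → u ≡ mate x ⊎ u ≡ mate y
    cross⇒N[c] (x≢c , y≢c , x~y , y≢) u~c
      with crossEdge⇒undominated (≢c⇒∈D x≢c) (≢c⇒∈D y≢c) x~y y≢
    ... | d , d∉D , N[d] with d Fin.≟ c
    ...   | yes refl = N[d] _ (≢c⇒∈D (~⇒≢ u~c)) u~c
    ...   | no d≢c = contradiction (≢c⇒∈D d≢c) d∉D

    edge-cases : ∀ {x y} → x ≢ c → x ~ y → y ≡ c ⊎ y ≡ mate x ⊎ Cross x y
    edge-cases {x} {y} x≢c x~y with y Fin.≟ c | y Fin.≟ mate x
    ... | yes eq | _ = inj₁ eq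
    ... | no _ | yes eq = inj₂ (inj₁ eq)
    ... | no y≢c | no y≢ = inj₂ (inj₂ (x≢c , y≢c , x~y , y≢))

    -- No cross edges: `G` is a spider with centre `c`.

    module NoCross (noCross : ∀ x y → ¬ Cross x y) where

      neighbours : ∀ {x y} → x ≢ c → x ~ y → y ≡ c ⊎ y ≡ mate x
      neighbours x≢c x~y with edge-cases x≢c x~y
      ... | inj₁ eq = inj₁ eq
      ... | inj₂ (inj₁ eq) = inj₂ eq
      ... | inj₂ (inj₂ cross) = contradiction cross (noCross _ _)

      -- Otherwise `v` and `mate v` would form a set closed under adjacency, and `c` could not be
      -- reached from `v`.
      attached : ∀ {v} → v ≢ c → v ~ c ⊎ mate v ~ c
      attached {v} v≢c with v ~? c | mate v ~? c
      ... | yes v~c | _ = inj₁ v~c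
      ... | no _ | yes m~c = inj₂ m~c
      ... | no v≁c | no m≁c = case Star-closed Pair closed (proj₁ unicyclic v c) (inj₁ refl) of λ where
          (inj₁ c≡v) → contradiction (sym c≡v) v≢c
          (inj₂ c≡m) → contradiction (sym c≡m) (mate≢c v≢c)
        where
        Pair : Fin n → Set
        Pair x = x ≡ v ⊎ x ≡ mate v
        closed : ∀ {x y} → Pair x → x ~ y → Pair y
        closed (inj₁ refl) x~y with neighbours v≢c x~y
        ... | inj₁ refl = contradiction x~y v≁c
        ... | inj₂ eq = inj₂ eq
        closed (inj₂ refl) x~y with neighbours (mate≢c v≢c) x~y
        ... | inj₁ refl = contradiction x~y m≁c
        ... | inj₂ eq = inj₁ (trans eq (mate² (≢c⇒∈D v≢c)))

      -- Only `c` and `mate y` can be neighbours of `y`, so they are its two neighbours on the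
      -- cycle.
      onCycle : ∀ {y} → y ≢ c → y List.∈ cyc → mate y List.∈ cyc × y ~ c
      onCycle y≢c y∈ with cycle⇒twoNeighbours isCycle y∈
      ... | x , z , x≢z , x∈ , z∈ , y~x , y~z with neighbours y≢c y~x | neighbours y≢c y~z
      ...   | inj₁ refl | inj₁ refl = contradiction refl x≢z
      ...   | inj₁ refl | inj₂ refl = z∈ , y~x
      ...   | inj₂ refl | inj₁ refl = x∈ , y~z
      ...   | inj₂ refl | inj₂ refl = contradiction refl x≢z

      -- Of two distinct cycle vertices one differs from `c`. By `onCycle` its mate is on the cycle
      -- as well, and a second use makes both adjacent to `c`.
      ∃triangle : ∃ λ a → a ≢ c × a ~ c × mate a ~ c
      ∃triangle with cycle⇒edge isCycle
      ... | y , _ , ye with cycle⇒twoNeighbours isCycle (cycleEdge⇒∈ ye)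
      ...   | x , z , x≢z , x∈ , z∈ , _ with x Fin.≟ c
      ...     | no x≢c with onCycle x≢c x∈
      ...       | mx∈ , x~c = x , x≢c , x~c , proj₂ (onCycle (mate≢c x≢c) mx∈)
      ∃triangle | y , _ , ye | x , z , x≢z , x∈ , z∈ , _ | yes refl with onCycle (≢-sym x≢z) z∈
      ... | mz∈ , z~c = z , ≢-sym x≢z , z~c , proj₂ (onCycle (mate≢c (≢-sym x≢z)) mz∈)

      triangle-cycle : ∀ {v} → v ≢ c → v ~ c → mate v ~ c → IsCycle G (c ∷ v ∷ mate v ∷ [])
      triangle-cycle v≢c v~c m~c =
        s≤s (s≤s (s≤s z≤n))
        , (≢-sym v≢c ∷ ≢-sym (mate≢c v≢c) ∷ []) ∷ (≢-sym (mate≢ (≢c⇒∈D v≢c)) ∷ []) ∷ [] ∷ []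
        , ~-sym v~c ∷ ~mate (≢c⇒∈D v≢c) ∷ m~c ∷ []

      -- The feet are the neighbours of `c` other than the triangle vertices `a` and `b`; the tips
      -- are their mates.
      spider : ∃ λ t → Model G (SpiderEdge {t})
      spider with ∃triangle
      ... | a , a≢c , a~c , b~c = t , record
        { vertex = vertex
        ; injective = injective _ _
        ; surjective = surjective
        ; adj⇔ = λ x y → mk⇔ (adj⇒ x y) adj⇐
        }
        where
        b : Fin n
        b = mate a

        a∈D : a ∈ D
        a∈D = ≢c⇒∈D a≢c

        -- The triangle `c`, `v`, `mate v` has the same edges as `c`, `a`, `b`; the edge from `v` to
        -- `mate v` then puts `v` on the latter.
        triangle-unique : ∀ {v} → v ≢ c → v ~ c → mate v ~ c → v ≡ a ⊎ v ≡ b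
        triangle-unique v≢c v~c m~c
          with cycleEdge⇒∈ {l = c ∷ a ∷ b ∷ []} (Equivalence.to (proj₂ (proj₂ unicyclic) _ _
            (triangle-cycle v≢c v~c m~c) (triangle-cycle a≢c a~c b~c) _ _) (inj₁ (there (here refl))))
        ... | here eq = contradiction eq v≢c
        ... | there (here eq) = inj₁ eq
        ... | there (there (here eq)) = inj₂ eq

        IsFoot : Fin n → Set
        IsFoot v = v ~ c × v ≢ a × v ≢ b

        isFoot? : Decidable IsFoot
        isFoot? v = (v ~? c) ×-dec ¬? (v Fin.≟ a) ×-dec ¬? (v Fin.≟ b)

        feet : List (Fin n)
        feet = filter isFoot? (allFin n)

        t : ℕ
        t = length feet

        foot′ : Fin t → Fin n
        foot′ = lookup feet

        isFoot : ∀ i → IsFoot (foot′ i)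
        isFoot i = proj₂ (∈-filter⁻ isFoot? {xs = allFin n} (∈-lookup i))

        foot-inj : ∀ {i j} → foot′ i ≡ foot′ j → i ≡ j
        foot-inj = lookup-injective (Unique.filter⁺ isFoot? (Unique.allFin⁺ n))

        ∃foot : ∀ {v} → IsFoot v → ∃ λ i → foot′ i ≡ v
        ∃foot p = index v∈ , sym (lookup-index v∈)
          where v∈ = ∈-filter⁺ isFoot? (∈-allFin _) p

        foot≢c : ∀ i → foot′ i ≢ c
        foot≢c i = ~⇒≢ (proj₁ (isFoot i))

        tip≁c : ∀ i → ¬ mate (foot′ i) ~ c
        tip≁c i m~c with triangle-unique (foot≢c i) (proj₁ (isFoot i)) m~c
        ... | inj₁ eq = proj₁ (proj₂ (isFoot i)) eq
        ... | inj₂ eq = proj₂ (proj₂ (isFoot i)) eq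

        vertex : Spider t → Fin n
        vertex hub = c
        vertex triˡ = a
        vertex triʳ = b
        vertex (foot i) = foot′ i
        vertex (tip i) = mate (foot′ i)

        vertex≢c : ∀ {x} → x ≢ hub → vertex x ≢ c
        vertex≢c {hub} x≢ = contradiction refl x≢
        vertex≢c {triˡ} x≢ = a≢c
        vertex≢c {triʳ} x≢ = mate≢c a≢c
        vertex≢c {foot i} x≢ = foot≢c i
        vertex≢c {tip i} x≢ = mate≢c (foot≢c i)

        mate-vertex : ∀ {x} → x ≢ hub → mate (vertex x) ≡ vertex (partner x)
        mate-vertex {hub} x≢ = contradiction refl x≢
        mate-vertex {triˡ} x≢ = refl
        mate-vertex {triʳ} x≢ = mate² a∈D
        mate-vertex {foot i} x≢ = refl
        mate-vertex {tip i} x≢ = mate² (≢c⇒∈D (foot≢c i))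

        injective : ∀ x y → vertex x ≡ vertex y → x ≡ y
        injective hub hub eq = refl
        injective hub triˡ eq = contradiction (sym eq) a≢c
        injective hub triʳ eq = contradiction (sym eq) (mate≢c a≢c)
        injective hub (foot j) eq = contradiction (sym eq) (foot≢c j)
        injective hub (tip j) eq = contradiction (sym eq) (mate≢c (foot≢c j))
        injective triˡ hub eq = contradiction eq a≢c
        injective triˡ triˡ eq = refl
        injective triˡ triʳ eq = contradiction (sym eq) (mate≢ a∈D)
        injective triˡ (foot j) eq = contradiction (sym eq) (proj₁ (proj₂ (isFoot j)))
        injective triˡ (tip j) eq = contradiction (subst (_~ c) eq a~c) (tip≁c j)
        injective triʳ hub eq = contradiction eq (mate≢c a≢c)
        injective triʳ triˡ eq = contradiction eq (mate≢ a∈D)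
        injective triʳ triʳ eq = refl
        injective triʳ (foot j) eq = contradiction (sym eq) (proj₂ (proj₂ (isFoot j)))
        injective triʳ (tip j) eq = contradiction (subst (_~ c) eq b~c) (tip≁c j)
        injective (foot i) hub eq = contradiction eq (foot≢c i)
        injective (foot i) triˡ eq = contradiction eq (proj₁ (proj₂ (isFoot i)))
        injective (foot i) triʳ eq = contradiction eq (proj₂ (proj₂ (isFoot i)))
        injective (foot i) (foot j) eq = cong foot (foot-inj eq)
        injective (foot i) (tip j) eq = contradiction (subst (_~ c) eq (proj₁ (isFoot i))) (tip≁c j)
        injective (tip i) hub eq = contradiction eq (mate≢c (foot≢c i))
        injective (tip i) triˡ eq = contradiction (subst (_~ c) (sym eq) a~c) (tip≁c i)
        injective (tip i) triʳ eq = contradiction (subst (_~ c) (sym eq) b~c) (tip≁c i)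
        injective (tip i) (foot j) eq = contradiction (subst (_~ c) (sym eq) (proj₁ (isFoot j))) (tip≁c i)
        injective (tip i) (tip j) eq =
          cong tip (foot-inj (mate-inj (≢c⇒∈D (foot≢c i)) (≢c⇒∈D (foot≢c j)) eq))

        surjective : ∀ u → ∃ λ x → vertex x ≡ u
        surjective u with u Fin.≟ c | u Fin.≟ a | u Fin.≟ b
        ... | yes refl | _ | _ = hub , refl
        ... | no _ | yes refl | _ = triˡ , refl
        ... | no _ | no _ | yes refl = triʳ , refl
        ... | no u≢c | no u≢a | no u≢b with attached u≢c
        ...   | inj₁ u~c with ∃foot (u~c , u≢a , u≢b)
        ...     | i , eq = foot i , eq
        surjective u | no u≢c | no u≢a | no u≢b | inj₂ m~c
          with ∃foot (m~c , u≢b ∘ mate-flip (≢c⇒∈D u≢c) , u≢a ∘ mate-inj (≢c⇒∈D u≢c) a∈D)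
        ... | i , eq = tip i , trans (cong mate eq) (mate² (≢c⇒∈D u≢c))

        hub-adj : ∀ x → vertex x ~ c → SpiderEdge x hub × SpiderEdge hub x
        hub-adj hub x~c = contradiction x~c ~-irrefl
        hub-adj triˡ x~c = triˡ-hub , hub-triˡ
        hub-adj triʳ x~c = triʳ-hub , hub-triʳ
        hub-adj (foot i) x~c = foot-hub i , hub-foot i
        hub-adj (tip i) x~c = contradiction x~c (tip≁c i)

        adj⇒ : ∀ x y → vertex x ~ vertex y → SpiderEdge x y
        adj⇒ x y x~y with hub? x
        ... | yes refl = proj₂ (hub-adj y (~-sym x~y))
        ... | no x≢ with neighbours (vertex≢c x≢) x~y
        ...   | inj₁ y≡c with injective y hub y≡c
        ...     | refl = proj₁ (hub-adj x x~y)
        adj⇒ x y x~y | no x≢ | inj₂ y≡m with injective y (partner x) (trans y≡m (mate-vertex x≢))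
        ... | refl = pair x≢

        adj⇐ : ∀ {x y} → SpiderEdge x y → vertex x ~ vertex y
        adj⇐ hub-triˡ = ~-sym a~c
        adj⇐ triˡ-hub = a~c
        adj⇐ hub-triʳ = ~-sym b~c
        adj⇐ triʳ-hub = b~c
        adj⇐ (hub-foot i) = ~-sym (proj₁ (isFoot i))
        adj⇐ (foot-hub i) = proj₁ (isFoot i)
        adj⇐ {x} (pair x≢) = subst (vertex x ~_) (mate-vertex x≢) (~mate (≢c⇒∈D (vertex≢c x≢)))

    -- The 5-cycle c, p, s, s′, q carries the only cross edge, so nothing is attached to it.
    module BothMates {s s′} (cross : Cross s s′) (p~c : mate s ~ c) (q~c : mate s′ ~ c) where

      p q : Fin n
      p = mate s
      q = mate s′

      s≢c : s ≢ c
      s≢c = proj₁ cross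
      s′≢c : s′ ≢ c
      s′≢c = proj₁ (proj₂ cross)
      s~s′ : s ~ s′
      s~s′ = proj₁ (proj₂ (proj₂ cross))
      s∈D : s ∈ D
      s∈D = ≢c⇒∈D s≢c
      s′∈D : s′ ∈ D
      s′∈D = ≢c⇒∈D s′≢c
      s′≢p : s′ ≢ p
      s′≢p = proj₂ (proj₂ (proj₂ cross))
      s≢q : s ≢ q
      s≢q = proj₂ (proj₂ (proj₂ (Cross-sym cross)))
      p≢q : p ≢ q
      p≢q = ~⇒≢ s~s′ ∘ mate-inj s∈D s′∈D

      -- Both `p` and `q` are neighbours of `c`, so `cross⇒N[c]` makes them the mates of the two
      -- ends of any cross edge.
      crossʳ : ∀ {x y} → Cross x y → y ≡ s ⊎ y ≡ s′
      crossʳ xy@(x≢c , y≢c , _) with cross⇒N[c] xy p~c | cross⇒N[c] xy q~c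
      ... | inj₂ eq | _ = inj₁ (mate-inj (≢c⇒∈D y≢c) s∈D (sym eq))
      ... | inj₁ _ | inj₂ eq = inj₂ (mate-inj (≢c⇒∈D y≢c) s′∈D (sym eq))
      ... | inj₁ eq | inj₁ eq′ = contradiction (trans eq (sym eq′)) p≢q

      p≁ : ∀ {y} → y ≢ c → y ≢ s → ¬ p ~ y
      p≁ y≢c y≢s p~y with edge-cases (mate≢c s≢c) p~y
      ... | inj₁ eq = y≢c eq
      ... | inj₂ (inj₁ eq) = y≢s (trans eq (mate² s∈D))
      ... | inj₂ (inj₂ xy) with crossʳ (Cross-sym xy)
      ...   | inj₁ eq = mate≢ s∈D eq
      ...   | inj₂ eq = s′≢p (sym eq)

      q≁s : ¬ q ~ s
      q≁s q~s with edge-cases (mate≢c s′≢c) q~s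
      ... | inj₁ eq = s≢c eq
      ... | inj₂ (inj₁ eq) = ~⇒≢ s~s′ (trans eq (mate² s′∈D))
      ... | inj₂ (inj₂ xy) with crossʳ (Cross-sym xy)
      ...   | inj₁ eq = s≢q (sym eq)
      ...   | inj₂ eq = mate≢ s′∈D eq

      s≁c : ¬ s ~ c
      s≁c s~c with cross⇒N[c] cross s~c
      ... | inj₁ eq = mate≢ s∈D (sym eq)
      ... | inj₂ eq = s≢q eq

      s′≁c : ¬ s′ ~ c
      s′≁c s′~c with cross⇒N[c] cross s′~c
      ... | inj₁ eq = s′≢p eq
      ... | inj₂ eq = mate≢ s′∈D (sym eq)

      vertex : Fin 5 → Fin n
      vertex 0F = c
      vertex 1F = p
      vertex 2F = s
      vertex 3F = s′
      vertex 4F = q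

      adj : ∀ i j → G (vertex i) (vertex j) ≡ cycleGraph 5 i j
      adj 0F 0F = ¬-not ~-irrefl
      adj 0F 1F = ~-sym p~c
      adj 0F 2F = ¬-not (s≁c ∘ ~-sym)
      adj 0F 3F = ¬-not (s′≁c ∘ ~-sym)
      adj 0F 4F = ~-sym q~c
      adj 1F 0F = p~c
      adj 1F 1F = ¬-not ~-irrefl
      adj 1F 2F = ~-sym (~mate s∈D)
      adj 1F 3F = ¬-not (p≁ s′≢c (≢-sym (~⇒≢ s~s′)))
      adj 1F 4F = ¬-not (p≁ (mate≢c s′≢c) (≢-sym s≢q))
      adj 2F 0F = ¬-not s≁c
      adj 2F 1F = ~mate s∈D
      adj 2F 2F = ¬-not ~-irrefl
      adj 2F 3F = s~s′
      adj 2F 4F = ¬-not (q≁s ∘ ~-sym)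
      adj 3F 0F = ¬-not s′≁c
      adj 3F 1F = ¬-not (p≁ s′≢c (≢-sym (~⇒≢ s~s′)) ∘ ~-sym)
      adj 3F 2F = ~-sym s~s′
      adj 3F 3F = ¬-not ~-irrefl
      adj 3F 4F = ~mate s′∈D
      adj 4F 0F = q~c
      adj 4F 1F = ¬-not (p≁ (mate≢c s′≢c) (≢-sym s≢q) ∘ ~-sym)
      adj 4F 2F = ¬-not q≁s
      adj 4F 3F = ~-sym (~mate s′∈D)
      adj 4F 4F = ¬-not ~-irrefl

      Covered : Fin n → Set
      Covered u = ∃ λ i → vertex i ≡ u

      covered-mate : ∀ i → vertex i ≢ c → Covered (mate (vertex i))
      covered-mate 0F ≢c = contradiction refl ≢c
      covered-mate 1F _ = 2F , sym (mate² s∈D)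
      covered-mate 2F _ = 1F , refl
      covered-mate 3F _ = 4F , refl
      covered-mate 4F _ = 3F , sym (mate² s′∈D)

      -- The neighbours of `c` are limited to `p` and `q`. From any other covered vertex an edge
      -- leads to `c`, to the mate, or along a cross edge into `s` or `s′`.
      closed : ∀ {x y} → Covered x → x ~ y → Covered y
      closed {x} (i , refl) x~y with x Fin.≟ c
      ... | yes eq with cross⇒N[c] cross (subst (_ ~_) eq (~-sym x~y))
      ...   | inj₁ y≡p = 1F , sym y≡p
      ...   | inj₂ y≡q = 4F , sym y≡q
      closed (i , refl) x~y | no x≢c with edge-cases x≢c x~y
      ... | inj₁ y≡c = 0F , sym y≡c
      ... | inj₂ (inj₁ refl) = covered-mate i x≢c
      ... | inj₂ (inj₂ xy) with crossʳ xy
      ...   | inj₁ y≡s = 2F , sym y≡s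
      ...   | inj₂ y≡s′ = 3F , sym y≡s′

      -- Distinct vertices of C₅ have distinct neighbourhoods, so injectivity of `vertex` follows
      -- from the adjacency table `adj`.
      twinFree : ∀ i j → (∀ k → cycleGraph 5 i k ≡ cycleGraph 5 j k) → i ≡ j
      twinFree = toWitness {a? = Fin.all? λ i → Fin.all? λ j →
        Fin.all? (λ k → cycleGraph 5 i k Bool.≟ cycleGraph 5 j k) →-dec i Fin.≟ j} _

      pentagon : Model G (Adj (cycleGraph 5))
      pentagon = record
        { vertex = vertex
        ; injective = λ {i} {j} eq → twinFree i j λ k →
            trans (sym (adj i k)) (trans (cong (λ u → G u (vertex k)) eq) (adj j k))
        ; surjective = λ u → Star-closed Covered closed (proj₁ unicyclic c u) (0F , refl)
        ; adj⇔ = λ i j → mk⇔ (trans (sym (adj i j))) (trans (adj i j))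
        }

    -- Every cross edge contains s, and the non-neighbours of s form an independent
    -- set of more than |D| / 2 vertices.
    module OneMate {s s′} (cross : Cross s s′) (p~c : mate s ~ c) (N[c] : ∀ {u} → u ~ c → u ≡ mate s) where

      s≢c : s ≢ c
      s≢c = proj₁ cross
      s∈D : s ∈ D
      s∈D = ≢c⇒∈D s≢c
      p~s : mate s ~ s
      p~s = ~-sym (~mate s∈D)

      s∈cross : ∀ {x y} → Cross x y → s ≡ x ⊎ s ≡ y
      s∈cross xy@(x≢c , y≢c , _) with cross⇒N[c] xy p~c
      ... | inj₁ eq = inj₁ (mate-inj s∈D (≢c⇒∈D x≢c) eq)
      ... | inj₂ eq = inj₂ (mate-inj s∈D (≢c⇒∈D y≢c) eq)

      ≁s? : Decidable (λ v → ¬ v ~ s)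
      ≁s? v = ¬? (v ~? s)

      I : Subset n
      I = ⟦ ≁s? ⟧

      -- A pair missing s altogether would be a component of its own.
      pair-meets-N[s] : ∀ {u} → u ≢ c → ¬ u ~ s → mate u ~ s
      pair-meets-N[s] {u} u≢c u≁s = decidable-stable (mate u ~? s) λ m≁s →
        let
          Pair : Fin n → Set
          Pair x = x ≡ u ⊎ x ≡ mate u
          pair≢c : ∀ {x} → Pair x → x ≢ c
          pair≢c = λ { (inj₁ refl) → u≢c ; (inj₂ refl) → mate≢c u≢c }
          pair≁s : ∀ {x} → Pair x → ¬ x ~ s
          pair≁s = λ { (inj₁ refl) → u≁s ; (inj₂ refl) → m≁s }
          pair-mate : ∀ {x} → Pair x → Pair (mate x)
          pair-mate = λ { (inj₁ refl) → inj₂ refl ; (inj₂ refl) → inj₁ (mate² (≢c⇒∈D u≢c)) }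
          closed : ∀ {x y} → Pair x → x ~ y → Pair y
          closed {x} {y} Px x~y = case edge-cases (pair≢c Px) x~y of λ where
            (inj₁ refl) → contradiction (subst (_~ s) (sym (N[c] x~y)) p~s) (pair≁s Px)
            (inj₂ (inj₁ refl)) → pair-mate Px
            (inj₂ (inj₂ xy)) → case s∈cross xy of λ where
              (inj₁ refl) → contradiction p~s (pair≁s (pair-mate Px))
              (inj₂ refl) → contradiction x~y (pair≁s Px)
        in pair≢c (Star-closed Pair closed (proj₁ unicyclic u c) (inj₁ refl)) refl

      -- An edge at `c` ends in `mate s`, a neighbour of `s`. A matching edge meets the
      -- neighbourhood of `s` by `pair-meets-N[s]`. A cross edge contains `s`, so its other end is
      -- adjacent to `s`.
      independent : Independent I
      independent {u} {v} u∈I v∈I u~v with ∈⟦⟧⁻ ≁s? u∈I | ∈⟦⟧⁻ ≁s? v∈I | u Fin.≟ c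
      ... | u≁s | v≁s | yes refl = v≁s (subst (_~ s) (sym (N[c] (~-sym u~v))) p~s)
      ... | u≁s | v≁s | no u≢c with edge-cases u≢c u~v
      ...   | inj₁ refl = u≁s (subst (_~ s) (sym (N[c] u~v)) p~s)
      ...   | inj₂ (inj₁ refl) = v≁s (pair-meets-N[s] u≢c u≁s)
      ...   | inj₂ (inj₂ uv) with s∈cross uv
      ...     | inj₁ refl = v≁s (~-sym u~v)
      ...     | inj₂ refl = u≁s u~v

      N[s]≢c : ∀ {x} → x ~ s → x ≢ c
      N[s]≢c x~s refl = ~⇒≢ p~s (sym (N[c] (~-sym x~s)))

      -- If `x` and `mate x` were both adjacent to `s`, their pair could be deleted: `s` dominates
      -- both of them and `mate s` dominates `c`. If `x` is `mate s`, its mate is `s` itself.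
      N[s]-mate : ∀ {x} → x ~ s → ¬ mate x ~ s
      N[s]-mate {x} x~s m~s with x Fin.≟ mate s
      ... | yes refl = ~-irrefl (subst (_~ s) (mate² s∈D) m~s)
      ... | no x≢p = ¬dominating-minus-pair x∈D dom′
        where
        x∈D : x ∈ D
        x∈D = ≢c⇒∈D (N[s]≢c x~s)
        s∈D′ : s ∈ D - x - mate x
        s∈D′ = ∈-minus₂⁺ s∈D (≢-sym (~⇒≢ x~s))
          λ eq → x≢p (mate-flip x∈D (sym eq))
        p∈D′ : mate s ∈ D - x - mate x
        p∈D′ = ∈-minus₂⁺ (mate∈ s∈D) (≢-sym x≢p)
          λ eq → ~⇒≢ x~s (mate-inj x∈D s∈D (sym eq))
        dom′ : Dominating G (D - x - mate x)
        dom′ v with v Fin.≟ c | v Fin.≟ x | v Fin.≟ mate x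
        ... | yes refl | _ | _ = inj₂ (mate s , p∈D′ , p~c)
        ... | no _ | yes refl | _ = inj₂ (s , s∈D′ , ~-sym x~s)
        ... | no _ | no _ | yes refl = inj₂ (s , s∈D′ , ~-sym m~s)
        ... | no v≢c | no v≢x | no v≢m = inj₁ (∈-minus₂⁺ (≢c⇒∈D v≢c) v≢x v≢m)

      ∁I⇒~s : ∀ {x} → x ∈ ∁ I → x ~ s
      ∁I⇒~s {x} x∈ = decidable-stable (x ~? s) (x∈∁p⇒x∉p x∈ ∘ ∈⟦⟧⁺ ≁s?)

      -- The complement of `I` is the neighbourhood of `s`, which `mate` carries injectively into
      -- `I`.
      ∁I≤I : ∣ ∁ I ∣ ≤ ∣ I ∣
      ∁I≤I = injection⇒∣∣≤ (∁ I) I mate (∈⟦⟧⁺ ≁s? ∘ N[s]-mate ∘ ∁I⇒~s)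
        (λ x∈ y∈ → mate-inj (≢c⇒∈D (N[s]≢c (∁I⇒~s x∈))) (≢c⇒∈D (N[s]≢c (∁I⇒~s y∈))))

      n≤2Γ : ∀ {γ} → IsUpperDomination G γ → n ≤ 2 * γ
      n≤2Γ {γ} maxΓ = begin
        n                  ≡⟨ sym (∣∁p∣+∣p∣≡n I) ⟩
        ∣ ∁ I ∣ + ∣ I ∣    ≤⟨ ℕ.+-monoˡ-≤ ∣ I ∣ ∁I≤I ⟩
        ∣ I ∣ + ∣ I ∣      ≡⟨ cong (∣ I ∣ +_) (sym (ℕ.+-identityʳ ∣ I ∣)) ⟩
        2 * ∣ I ∣          ≤⟨ ℕ.*-monoʳ-≤ 2 (independent⇒∣∣≤Γ maxΓ independent) ⟩
        2 * γ              ∎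
        where open ℕ.≤-Reasoning

    -- `OneMate.n≤2Γ` bounds `n` by 2Γ, which is the size of `D`; but `D` misses `c`.
    oneMate⇒⊥ : ∀ {γ s s′} → IsUpperDomination G γ → ∣ D ∣ ≡ 2 * γ →
      Cross s s′ → mate s ~ c → ¬ ¬ mate s′ ~ c
    oneMate⇒⊥ {γ} {s} maxΓ ∣D∣≡ cross p~c q≁c =
      ℕ.<⇒≱ ∣D∣<n (ℕ.≤-trans (OneMate.n≤2Γ cross p~c N[c] maxΓ) (ℕ.≤-reflexive (sym ∣D∣≡)))
      where
      N[c] : ∀ {u} → u ~ c → u ≡ mate s
      N[c] u~c = case cross⇒N[c] cross u~c of λ { (inj₁ eq) → eq ; (inj₂ refl) → contradiction u~c q≁c }
      ∣D∣<n : ∣ D ∣ < n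
      ∣D∣<n = ℕ.<-≤-trans (p⊂q⇒∣p∣<∣q∣ (⊂-insert c∉D)) (∣p∣≤n (D ∪ ⁅ c ⁆))

    classify : ∀ {γ} → IsUpperDomination G γ → ∣ D ∣ ≡ 2 * γ →
      Model G (Adj (cycleGraph 5)) ⊎ ∃ λ t → Model G (SpiderEdge {t})
    classify maxΓ ∣D∣≡ with Fin.any? (λ x → Fin.any? (cross? x))
    ... | no none = inj₂ (NoCross.spider λ x y xy → none (x , y , xy))
    ... | yes (s , s′ , cross) with mate s ~? c | mate s′ ~? c
    ...   | yes p~c | yes q~c = inj₁ (BothMates.pentagon cross p~c q~c)
    ...   | yes p~c | no q≁c = contradiction q≁c (oneMate⇒⊥ maxΓ ∣D∣≡ cross p~c)
    ...   | no p≁c | yes q~c = contradiction p≁c (oneMate⇒⊥ maxΓ ∣D∣≡ (Cross-sym cross) q~c)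
    -- Something in `D` dominates `c`, and the cross edge forces it to be one of the two mates.
    ...   | no p≁c | no q≁c with dom c
    ...     | inj₁ c∈D = contradiction c∈D c∉D
    ...     | inj₂ (u , _ , u~c) with cross⇒N[c] cross u~c
    ...       | inj₁ refl = contradiction u~c p≁c
    ...       | inj₂ refl = contradiction u~c q≁c

  2Γ⇒C₅⊎spider : ∀ {γ} → IsUpperDomination G γ → ∣ D ∣ ≡ 2 * γ →
    Model G (Adj (cycleGraph 5)) ⊎ ∃ λ t → Model G (SpiderEdge {t})
  2Γ⇒C₅⊎spider {γ} maxΓ ∣D∣≡ with Fin.any? (λ v → ¬? (v ∈? D))
  ... | no none = contradiction (λ v → decidable-stable (v ∈? D) λ v∉D → none (v , v∉D)) full⇒⊥
  ... | yes (c , c∉D) = AllButOne.classify c c∉D ≢c⇒∈D maxΓ ∣D∣≡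
    where
    -- A second missing vertex would make `n` at least |D| + 2, whereas `n` is at most 1 + 2Γ = |D|
    -- + 1.
    ≢c⇒∈D : ∀ {v} → v ≢ c → v ∈ D
    ≢c⇒∈D {v} v≢c = decidable-stable (v ∈? D) λ v∉D →
      let v∉D∪c : v ∉ D ∪ ⁅ c ⁆
          v∉D∪c = λ v∈ → case x∈p∪q⁻ D ⁅ c ⁆ v∈ of λ where
            (inj₁ v∈D) → v∉D v∈D
            (inj₂ v∈c) → v≢c (x∈⁅y⁆⇒x≡y c v∈c)
      in ℕ.<-irrefl refl (begin-strict
        suc ∣ D ∣                ≤⟨ p⊂q⇒∣p∣<∣q∣ (⊂-insert c∉D) ⟩
        ∣ D ∪ ⁅ c ⁆ ∣            <⟨ p⊂q⇒∣p∣<∣q∣ (⊂-insert v∉D∪c) ⟩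
        ∣ (D ∪ ⁅ c ⁆) ∪ ⁅ v ⁆ ∣  ≤⟨ ∣p∣≤n ((D ∪ ⁅ c ⁆) ∪ ⁅ v ⁆) ⟩
        n                        ≤⟨ unicyclic⇒n≤1+2Γ unicyclic maxΓ ⟩
        suc (2 * γ)              ≡⟨ cong suc (sym ∣D∣≡) ⟩
        suc ∣ D ∣                ∎)
      where open ℕ.≤-Reasoning

-- Converse direction: all vertices but one as a minimal paired dominating set.

module HubComplement {n} {G : Graph n} {V : Set} {E : V → V → Set} (M : Model G E)
  (simple : IsSimple G) (hub : V) (partner : V → V)
  (partner≢hub : ∀ {x} → x ≢ hub → partner x ≢ hub)
  (partner≢ : ∀ {x} → x ≢ hub → partner x ≢ x)
  (partner² : ∀ x → partner (partner x) ≡ x)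
  (partner-edge : ∀ {x} → x ≢ hub → E x (partner x))
  {a : V} (a≢hub : a ≢ hub) (a-hub : E a hub)
  -- Minimality, stated in the model: a dominating `B` that avoids the hub and is matched by `m`
  -- contains every other vertex.
  (rigid : ∀ (B : V → Set) (m : V → V) → ¬ B hub → (∀ y → B y ⊎ ∃ λ x → B x × E x y) →
    (∀ x → B x → B (m x) × E x (m x) × m (m x) ≡ x) → ∀ {y} → y ≢ hub → B y)
  where

  open Model M
  open SimpleGraph G simple

  c : Fin n
  c = vertex hub

  ∈∁c⁺ : ∀ {x} → x ≢ hub → vertex x ∈ ∁ ⁅ c ⁆
  ∈∁c⁺ x≢ = x∉p⇒x∈∁p (x≢ ∘ injective ∘ x∈⁅y⁆⇒x≡y c)

  ∈∁c⁻ : ∀ {v} → v ∈ ∁ ⁅ c ⁆ → code v ≢ hub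
  ∈∁c⁻ {v} v∈ eq = x∈∁p⇒x∉p v∈
    (subst (_∈ ⁅ c ⁆) (trans (cong vertex (sym eq)) (vertex-code v)) (x∈⁅x⁆ c))

  μ : Fin n → Fin n
  μ v = vertex (partner (code v))

  paired : PairedDominating G (∁ ⁅ c ⁆)
  paired = dom , μ , λ v v∈ →
      ∈∁c⁺ (partner≢hub (∈∁c⁻ v∈))
    , (λ eq → partner≢ (∈∁c⁻ v∈) (injective (trans eq (sym (vertex-code v)))))
    , subst (_~ μ v) (vertex-code v) (Equivalence.from (adj⇔ _ _) (partner-edge (∈∁c⁻ v∈)))
    , trans (cong (vertex ∘ partner) (code-vertex _)) (trans (cong vertex (partner² _)) (vertex-code v))
    where
    dom : Dominating G (∁ ⁅ c ⁆)
    dom v with v ∈? ⁅ c ⁆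
    ... | no v∉ = inj₁ (x∉p⇒x∈∁p v∉)
    ... | yes v∈ with x∈⁅y⁆⇒x≡y c v∈
    ...   | refl = inj₂ (vertex a , ∈∁c⁺ a≢hub , Equivalence.from (adj⇔ a hub) a-hub)

  minimalPaired : MinimalPairedDominating G (∁ ⁅ c ⁆)
  minimalPaired = paired , λ where
    S (S⊆ , v , v∈ , v∉S) (domS , m , matched) →
      let
        B : V → Set
        B x = vertex x ∈ S
        dominated : ∀ y → B y ⊎ ∃ λ x → B x × E x y
        dominated y = case domS (vertex y) of λ where
          (inj₁ y∈S) → inj₁ y∈S
          (inj₂ (u , u∈S , u~y)) → inj₂ (code u , subst (_∈ S) (sym (vertex-code u)) u∈S
            , Equivalence.to (adj⇔ _ _) (subst (_~ vertex y) (sym (vertex-code u)) u~y))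
        mated : ∀ x → B x → B (code (m (vertex x))) × E x (code (m (vertex x)))
          × code (m (vertex (code (m (vertex x))))) ≡ x
        mated x Bx = case matched (vertex x) Bx of λ where
          (m∈S , _ , x~m , m²) →
            subst (_∈ S) (sym (vertex-code _)) m∈S
            , Equivalence.to (adj⇔ _ _) (subst (vertex x ~_) (sym (vertex-code _)) x~m)
            , trans (cong (code ∘ m) (vertex-code _)) (trans (cong code m²) (code-vertex x))
      in v∉S (subst (_∈ S) (vertex-code v)
        (rigid B (code ∘ m ∘ vertex) (λ c∈S → x∈∁p⇒x∉p (S⊆ c∈S) (x∈⁅x⁆ c)) dominated mated (∈∁c⁻ v∈)))

odd⇒Γpr≡2Γ : ∀ {n γ γpr k c} {G : Graph n} → IsSimple G →
  IsUpperDomination G γ → IsUpperPairedDomination G γpr →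
  MinimalPairedDominating G (∁ ⁅ c ⁆) → n ≡ suc (2 * k) → 2 * γ ≤ n → γpr ≡ 2 * γ
odd⇒Γpr≡2Γ {n} {γ} {γpr} {k} {c} {G} simple maxΓ maxΓpr min∁c n≡ 2γ≤n =
  ℕ.≤-antisym (SimpleGraph.Γpr≤2Γ G simple maxΓ maxΓpr) (begin
    2 * γ        ≤⟨ ℕ.*-monoʳ-≤ 2 γ≤k ⟩
    2 * k        ≡⟨ ℕ.suc-injective (begin-equality
      suc (2 * k)              ≡⟨ sym n≡ ⟩
      n                        ≡⟨ sym (∣∁p∣+∣p∣≡n ⁅ c ⁆) ⟩
      ∣ ∁ ⁅ c ⁆ ∣ + ∣ ⁅ c ⁆ ∣  ≡⟨ cong (∣ ∁ ⁅ c ⁆ ∣ +_) (∣⁅x⁆∣≡1 c) ⟩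
      ∣ ∁ ⁅ c ⁆ ∣ + 1          ≡⟨ ℕ.+-comm _ 1 ⟩
      suc ∣ ∁ ⁅ c ⁆ ∣          ∎) ⟩
    ∣ ∁ ⁅ c ⁆ ∣  ≤⟨ proj₂ maxΓpr (∁ ⁅ c ⁆) min∁c ⟩
    γpr          ∎)
  where
  open ℕ.≤-Reasoning
  γ≤k : γ ≤ k
  -- Parity: 2γ is at most 2k + 1, hence below 2(k + 1).
  γ≤k = s≤s⁻¹ (ℕ.*-cancelˡ-< 2 γ (suc k) (begin-strict
    2 * γ            ≤⟨ 2γ≤n ⟩
    n                ≡⟨ n≡ ⟩
    suc (2 * k)      <⟨ ℕ.n<1+n _ ⟩
    2 + 2 * k        ≡⟨ sym (ℕ.*-suc 2 k) ⟩
    2 * suc k        ∎))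

-- Spiders attain Γpr = 2Γ.

module SpiderParameters {n t} {G : Graph n} (simple : IsSimple G) (M : Model G (SpiderEdge {t})) where
  open Model M
  open SimpleGraph G simple

  partner≢hub : ∀ {x : Spider t} → x ≢ hub → partner x ≢ hub
  partner≢hub {hub} x≢ = x≢
  partner≢hub {triˡ} _ ()
  partner≢hub {triʳ} _ ()
  partner≢hub {foot _} _ ()
  partner≢hub {tip _} _ ()

  partner≢ : ∀ {x : Spider t} → x ≢ hub → partner x ≢ x
  partner≢ {hub} x≢ = x≢
  partner≢ {triˡ} _ ()
  partner≢ {triʳ} _ ()
  partner≢ {foot _} _ ()
  partner≢ {tip _} _ ()

  partner² : ∀ (x : Spider t) → partner (partner x) ≡ x
  partner² hub = refl
  partner² triˡ = refl
  partner² triʳ = refl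
  partner² (foot _) = refl
  partner² (tip _) = refl

  edge⇒partner : ∀ {x y : Spider t} → x ≢ hub → y ≢ hub → SpiderEdge x y → y ≡ partner x
  edge⇒partner x≢ y≢ (pair _) = refl
  edge⇒partner x≢ y≢ hub-triˡ = contradiction refl x≢
  edge⇒partner x≢ y≢ hub-triʳ = contradiction refl x≢
  edge⇒partner x≢ y≢ (hub-foot _) = contradiction refl x≢
  edge⇒partner x≢ y≢ triˡ-hub = contradiction refl y≢
  edge⇒partner x≢ y≢ triʳ-hub = contradiction refl y≢
  edge⇒partner x≢ y≢ (foot-hub _) = contradiction refl y≢

  -- Away from the hub a vertex is adjacent only to its partner. So if `x` dominates `y`, then `y`
  -- is `partner x`, which is also where `m` must send `x`.
  rigid : ∀ (B : Spider t → Set) (m : Spider t → Spider t) → ¬ B hub →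
    (∀ y → B y ⊎ ∃ λ x → B x × SpiderEdge x y) →
    (∀ x → B x → B (m x) × SpiderEdge x (m x) × m (m x) ≡ x) → ∀ {y} → y ≢ hub → B y
  rigid B m ¬Bhub dominated mated {y} y≢ with dominated y
  ... | inj₁ By = By
  ... | inj₂ (x , Bx , x-y) with mated x Bx
  ...   | Bm , x-m , _ = subst B
    (trans (edge⇒partner x≢ (λ eq → ¬Bhub (subst B eq Bm)) x-m) (sym (edge⇒partner x≢ y≢ x-y))) Bm
    where
    x≢ : x ≢ hub
    x≢ refl = ¬Bhub Bx

  open HubComplement M simple hub partner partner≢hub partner≢ partner² pair
    {triˡ} (λ ()) triˡ-hub rigid public using (minimalPaired)

  infix 4 _⊑_

  -- Inclusion of the closed neighbourhood of `x` in that of `z`.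
  _⊑_ : Spider t → Spider t → Set
  x ⊑ z = ∀ {y} → x ≡ y ⊎ SpiderEdge x y → z ≡ y ⊎ SpiderEdge z y

  triˡ⊑hub : triˡ ⊑ hub
  triˡ⊑hub (inj₁ refl) = inj₂ hub-triˡ
  triˡ⊑hub (inj₂ triˡ-hub) = inj₁ refl
  triˡ⊑hub (inj₂ (pair _)) = inj₂ hub-triʳ

  triʳ⊑hub : triʳ ⊑ hub
  triʳ⊑hub (inj₁ refl) = inj₂ hub-triʳ
  triʳ⊑hub (inj₂ triʳ-hub) = inj₁ refl
  triʳ⊑hub (inj₂ (pair _)) = inj₂ hub-triˡ

  triˡ⊑triʳ : triˡ ⊑ triʳ
  triˡ⊑triʳ (inj₁ refl) = inj₂ (pair λ ())
  triˡ⊑triʳ (inj₂ triˡ-hub) = inj₂ triʳ-hub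
  triˡ⊑triʳ (inj₂ (pair _)) = inj₁ refl

  tip⊑foot : ∀ i → tip i ⊑ foot i
  tip⊑foot i (inj₁ refl) = inj₂ (pair λ ())
  tip⊑foot i (inj₂ (pair _)) = inj₁ refl

  module _ {D : Subset n} (minD : MinimalDominating G D) where

    -- With `z` present, `x` has no private vertex left.
    ⊑⇒¬both : ∀ {x z} → x ⊑ z → z ≢ x → vertex x ∈ D → ¬ vertex z ∈ D
    ⊑⇒¬both {x} {z} x⊑z z≢x x∈D z∈D = minimalDominating⇒irredundant minD x∈D λ y x≼y →
      vertex z , z∈D , z≢x ∘ injective , fromModel y (x⊑z (toModel y x≼y))
      where
      toModel : ∀ y → vertex x ≼ y → x ≡ code y ⊎ SpiderEdge x (code y)
      toModel y (inj₁ refl) = inj₁ (sym (code-vertex x))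
      toModel y (inj₂ x~y) = inj₂ (Equivalence.to (adj⇔ _ _) (subst (vertex x ~_) (sym (vertex-code y)) x~y))
      fromModel : ∀ y → z ≡ code y ⊎ SpiderEdge z (code y) → vertex z ≼ y
      fromModel y (inj₁ refl) = inj₁ (vertex-code y)
      fromModel y (inj₂ e) = inj₂ (subst (vertex z ~_) (vertex-code y) (Equivalence.from (adj⇔ _ _) e))

    -- D meets the triangle and each foot-tip pair at most once, so moving within these
    -- cliques maps D into its complement.
    away : Spider t → Spider t
    away hub = triˡ
    away x   = partner x

    away-partner : ∀ {x} → x ≢ hub → away x ≡ partner x
    away-partner {hub} x≢ = contradiction refl x≢
    away-partner {triˡ} _ = refl
    away-partner {triʳ} _ = refl
    away-partner {foot _} _ = refl
    away-partner {tip _} _ = refl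

    away∉D : ∀ x → vertex x ∈ D → ¬ vertex (away x) ∈ D
    away∉D hub hub∈ triˡ∈ = ⊑⇒¬both triˡ⊑hub (λ ()) triˡ∈ hub∈
    away∉D triˡ triˡ∈ triʳ∈ = ⊑⇒¬both triˡ⊑triʳ (λ ()) triˡ∈ triʳ∈
    away∉D triʳ triʳ∈ triˡ∈ = ⊑⇒¬both triˡ⊑triʳ (λ ()) triˡ∈ triʳ∈
    away∉D (foot i) foot∈ tip∈ = ⊑⇒¬both (tip⊑foot i) (λ ()) tip∈ foot∈
    away∉D (tip i) tip∈ foot∈ = ⊑⇒¬both (tip⊑foot i) (λ ()) tip∈ foot∈

    -- The one possible collision of `away`: `hub` and `triʳ` both go to `triˡ`, but they cannot
    -- both lie in `D`.
    away-hub : ∀ {y} → vertex hub ∈ D → vertex y ∈ D → y ≢ hub → triˡ ≢ partner y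
    away-hub {hub} _ _ y≢ _ = y≢ refl
    away-hub {triʳ} hub∈ triʳ∈ _ _ = ⊑⇒¬both triʳ⊑hub (λ ()) triʳ∈ hub∈

    away-inj : ∀ {x y} → vertex x ∈ D → vertex y ∈ D → away x ≡ away y → x ≡ y
    away-inj {x} {y} x∈ y∈ eq with hub? x | hub? y
    ... | yes refl | yes refl = refl
    ... | yes refl | no y≢ = contradiction (trans eq (away-partner y≢)) (away-hub x∈ y∈ y≢)
    ... | no x≢ | yes refl = contradiction (trans (sym eq) (away-partner x≢)) (away-hub y∈ x∈ x≢)
    ... | no x≢ | no y≢ = trans (sym (partner² x)) (trans
      (cong partner (trans (sym (away-partner x≢)) (trans eq (away-partner y≢)))) (partner² y))

    2∣D∣≤n : 2 * ∣ D ∣ ≤ n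
    2∣D∣≤n = begin
      2 * ∣ D ∣        ≡⟨ cong (∣ D ∣ +_) (ℕ.+-identityʳ ∣ D ∣) ⟩
      ∣ D ∣ + ∣ D ∣    ≤⟨ ℕ.+-monoˡ-≤ ∣ D ∣ (injection⇒∣∣≤ D (∁ D) (vertex ∘ away ∘ code)
                          (λ v∈D → x∉p⇒x∈∁p (away∉D _ (decode v∈D)))
                          (λ u∈D v∈D eq → code-injective (away-inj (decode u∈D) (decode v∈D) (injective eq)))) ⟩
      ∣ ∁ D ∣ + ∣ D ∣  ≡⟨ ∣∁p∣+∣p∣≡n D ⟩
      n                ∎
      where
      open ℕ.≤-Reasoning
      decode : ∀ {v} → v ∈ D → vertex (code v) ∈ D
      decode {v} = subst (_∈ D) (sym (vertex-code v))
      code-injective : ∀ {u v} → code u ≡ code v → u ≡ v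
      code-injective {u} {v} eq = trans (sym (vertex-code u)) (trans (cong vertex eq) (vertex-code v))

  Γpr≡2Γ : ∀ {γ γpr} → n ≡ 3 + t + t → IsUpperDomination G γ → IsUpperPairedDomination G γpr → γpr ≡ 2 * γ
  Γpr≡2Γ n≡ maxΓ@((D , minD , refl) , _) maxΓpr =
    odd⇒Γpr≡2Γ {k = suc t} simple maxΓ maxΓpr minimalPaired (trans n≡ size) (2∣D∣≤n minD)
    where
    size : 3 + t + t ≡ suc (2 * suc t)
    size = cong suc (trans (cong (2 +_) (cong (t +_) (sym (ℕ.+-identityʳ t)))) (sym (ℕ.*-suc 2 t)))

-- The numbered graph `subdividedStarTriangle t` as a spider.

module SpiderModel (t : ℕ) where

  vertex : Spider t → Fin (3 + t + t)
  vertex hub = zero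
  vertex triˡ = suc zero
  vertex triʳ = suc (suc zero)
  vertex (foot i) = suc (suc (suc (i Fin.↑ˡ t)))
  vertex (tip i) = suc (suc (suc (t Fin.↑ʳ i)))

  code : Fin (3 + t + t) → Spider t
  code zero = hub
  code (suc zero) = triˡ
  code (suc (suc zero)) = triʳ
  code (suc (suc (suc k))) = [ foot , tip ]′ (Fin.splitAt t k)

  code-vertex : ∀ x → code (vertex x) ≡ x
  code-vertex hub = refl
  code-vertex triˡ = refl
  code-vertex triʳ = refl
  code-vertex (foot i) = cong [ foot , tip ]′ (Fin.splitAt-↑ˡ t i t)
  code-vertex (tip i) = cong [ foot , tip ]′ (Fin.splitAt-↑ʳ t t i)

  surjective : ∀ u → ∃ λ x → vertex x ≡ u
  surjective zero = hub , refl
  surjective (suc zero) = triˡ , refl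
  surjective (suc (suc zero)) = triʳ , refl
  surjective (suc (suc (suc k))) with Fin.splitAt t k in eq
  ... | inj₁ i = foot i , cong (λ k → suc (suc (suc k))) (Fin.splitAt⁻¹-↑ˡ eq)
  ... | inj₂ i = tip i , cong (λ k → suc (suc (suc k))) (Fin.splitAt⁻¹-↑ʳ eq)

  foot<t : ∀ (i : Fin t) → (toℕ (i Fin.↑ˡ t) <ᵇ t) ≡ true
  foot<t i rewrite Fin.toℕ-↑ˡ i t = dec-true (toℕ i ℕ.<? t) (Fin.toℕ<n i)

  tip≮t : ∀ (i : Fin t) → (toℕ (t Fin.↑ʳ i) <ᵇ t) ≡ false
  tip≮t i rewrite Fin.toℕ-↑ʳ t i = dec-false (t + toℕ i ℕ.<? t) (ℕ.m+n≮m t (toℕ i))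

  foot≢foot+t : ∀ (i j : Fin t) → (toℕ (j Fin.↑ˡ t) ≡ᵇ toℕ (i Fin.↑ˡ t) + t) ≡ false
  foot≢foot+t i j rewrite Fin.toℕ-↑ˡ i t | Fin.toℕ-↑ˡ j t =
    dec-false (toℕ j ℕ.≟ toℕ i + t) λ eq → ℕ.m+n≮n (toℕ i) t (subst (_< t) eq (Fin.toℕ<n j))

  tip≡foot+t : ∀ (i j : Fin t) → (toℕ (t Fin.↑ʳ j) ≡ᵇ toℕ (i Fin.↑ˡ t) + t) ≡ does (i Fin.≟ j)
  tip≡foot+t i j rewrite Fin.toℕ-↑ˡ i t | Fin.toℕ-↑ʳ t j with i Fin.≟ j
  ... | yes refl = dec-true (t + toℕ i ℕ.≟ toℕ i + t) (ℕ.+-comm t (toℕ i))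
  ... | no i≢j = dec-false (t + toℕ j ℕ.≟ toℕ i + t) λ eq →
    i≢j (Fin.toℕ-injective (sym (ℕ.+-cancelˡ-≡ t _ _ (trans eq (ℕ.+-comm (toℕ i) t)))))

  -- The values of starTriEdge, which lists every edge in one direction only.
  arc : Spider t → Spider t → Bool
  arc hub triˡ = true
  arc hub triʳ = true
  arc hub (foot _) = true
  arc triˡ triʳ = true
  arc (foot i) (tip j) = does (i Fin.≟ j)
  arc _ _ = false

  starTriEdge≡arc : ∀ x y → starTriEdge t (toℕ (vertex x)) (toℕ (vertex y)) ≡ arc x y
  starTriEdge≡arc hub hub = refl
  starTriEdge≡arc hub triˡ = refl
  starTriEdge≡arc hub triʳ = refl
  starTriEdge≡arc hub (foot i) rewrite foot<t i = refl
  starTriEdge≡arc hub (tip i) rewrite tip≮t i = refl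
  starTriEdge≡arc triˡ hub = refl
  starTriEdge≡arc triˡ triˡ = refl
  starTriEdge≡arc triˡ triʳ = refl
  starTriEdge≡arc triˡ (foot i) = refl
  starTriEdge≡arc triˡ (tip i) = refl
  starTriEdge≡arc triʳ y = refl
  starTriEdge≡arc (foot i) hub rewrite foot<t i = refl
  starTriEdge≡arc (foot i) triˡ rewrite foot<t i = refl
  starTriEdge≡arc (foot i) triʳ rewrite foot<t i = refl
  starTriEdge≡arc (foot i) (foot j) rewrite foot<t i = foot≢foot+t i j
  starTriEdge≡arc (foot i) (tip j) rewrite foot<t i = tip≡foot+t i j
  starTriEdge≡arc (tip i) y rewrite tip≮t i = refl

  arc⇒edge : ∀ x y → arc x y ≡ true → SpiderEdge x y × SpiderEdge y x
  arc⇒edge hub triˡ _ = hub-triˡ , triˡ-hub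
  arc⇒edge hub triʳ _ = hub-triʳ , triʳ-hub
  arc⇒edge hub (foot i) _ = hub-foot i , foot-hub i
  arc⇒edge triˡ triʳ _ = pair (λ ()) , pair (λ ())
  arc⇒edge (foot i) (tip j) eq with i Fin.≟ j
  ... | yes refl = pair (λ ()) , pair (λ ())

  edge⇒arc : ∀ {x y} → SpiderEdge x y → arc x y ∨ arc y x ≡ true
  edge⇒arc hub-triˡ = refl
  edge⇒arc triˡ-hub = refl
  edge⇒arc hub-triʳ = refl
  edge⇒arc triʳ-hub = refl
  edge⇒arc (hub-foot i) = refl
  edge⇒arc (foot-hub i) = refl
  edge⇒arc {hub} (pair x≢) = contradiction refl x≢
  edge⇒arc {triˡ} (pair x≢) = refl
  edge⇒arc {triʳ} (pair x≢) = refl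
  edge⇒arc {foot i} (pair x≢) = cong (_∨ false) (dec-true (i Fin.≟ i) refl)
  edge⇒arc {tip i} (pair x≢) = dec-true (i Fin.≟ i) refl

  model : Model (subdividedStarTriangle t) SpiderEdge
  model = record
    { vertex = vertex
    ; injective = λ {x} {y} eq → trans (sym (code-vertex x)) (trans (cong code eq) (code-vertex y))
    ; surjective = surjective
    ; adj⇔ = λ x y → mk⇔ (to x y) (λ e → trans (cong₂ _∨_ (starTriEdge≡arc x y) (starTriEdge≡arc y x)) (edge⇒arc e))
    }
    where
    to : ∀ x y → Adj (subdividedStarTriangle t) (vertex x) (vertex y) → SpiderEdge x y
    to x y adj with arc x y in xy | trans (sym (cong₂ _∨_ (starTriEdge≡arc x y) (starTriEdge≡arc y x))) adj
    ... | true | _ = proj₁ (arc⇒edge x y xy)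
    ... | false | yx = proj₂ (arc⇒edge y x yx)

-- The triangle is the spider without rays, which lets C₃ share the spider argument.
C₃≅spider₀ : cycleGraph 3 ≅ subdividedStarTriangle 0
C₃≅spider₀ = ↔-id (Fin 3) , λ u v →
  mk⇔ (trans (sym (agree u v))) (trans (agree u v))
  where
  agree : ∀ u v → cycleGraph 3 u v ≡ subdividedStarTriangle 0 u v
  agree = toWitness {a? = Fin.all? λ u → Fin.all? λ v →
    cycleGraph 3 u v Bool.≟ subdividedStarTriangle 0 u v} _

C₅-simple : IsSimple (cycleGraph 5)
C₅-simple =
    toWitness {a? = Fin.all? λ u → Fin.all? λ v → cycleGraph 5 u v Bool.≟ cycleGraph 5 v u} _
  , toWitness {a? = Fin.all? λ v → cycleGraph 5 v v Bool.≟ false} _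

-- The 5-cycle attains Γpr = 2Γ.

module C₅ where
  open SimpleGraph (cycleGraph 5) C₅-simple

  Redundant : Subset 5 → Fin 5 → Set
  Redundant B i = i ∈ B × (∀ j → i ≼ j → ∃ λ k → k ∈ B × k ≢ i × k ≼ j)

  redundant? : ∀ B → Decidable (Redundant B)
  redundant? B i = (i ∈? B) ×-dec Fin.all? λ j → ≼? i j →-dec
    Fin.any? λ k → (k ∈? B) ×-dec ¬? (k Fin.≟ i) ×-dec ≼? k j
    where
    ≼? : ∀ i j → Dec (i ≼ j)
    ≼? i j = (i Fin.≟ j) ⊎-dec (i ~? j)

  small⊎redundant? : ∀ B → Dec (∣ B ∣ ≤ 2 ⊎ ∃ (Redundant B))
  small⊎redundant? B = (∣ B ∣ ℕ.≤? 2) ⊎-dec Fin.any? (redundant? B)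

  -- Verified by exhausting the 32 subsets. It yields Γ(C₅) ≤ 2, since a minimal dominating set has
  -- no redundant member.
  small⊎redundant : ∀ B → ∣ B ∣ ≤ 2 ⊎ ∃ (Redundant B)
  small⊎redundant B = decidable-stable (small⊎redundant? B) λ ¬B →
    toWitnessFalse {a? = anySubset? (¬? ∘ small⊎redundant?)} _ (B , ¬B)

module C₅Parameters {n} {G : Graph n} (simple : IsSimple G) (M : Model G (Adj (cycleGraph 5))) where
  open Model M
  open SimpleGraph G simple

  -- The perfect matching of the path 1, 2, 3, 4 left after removing 0, which is fixed by default.
  mirror : Fin 5 → Fin 5
  mirror 0F = 0F
  mirror 1F = 2F
  mirror 2F = 1F
  mirror 3F = 4F
  mirror 4F = 3F

  module Rigid (B : Fin 5 → Set) (m : Fin 5 → Fin 5) (¬B0 : ¬ B 0F)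
    (dominated : ∀ y → B y ⊎ ∃ λ x → B x × Adj (cycleGraph 5) x y)
    (mated : ∀ x → B x → B (m x) × Adj (cycleGraph 5) x (m x) × m (m x) ≡ x) where

    m1 : B 1F → m 1F ≡ 2F
    m1 B1 with m 1F | mated 1F B1
    ... | 0F | B0 , _ = contradiction B0 ¬B0
    ... | 2F | _ = refl
    ... | 1F | _ , () , _
    ... | 3F | _ , () , _
    ... | 4F | _ , () , _

    m4 : B 4F → m 4F ≡ 3F
    m4 B4 with m 4F | mated 4F B4
    ... | 0F | B0 , _ = contradiction B0 ¬B0
    ... | 3F | _ = refl
    ... | 1F | _ , () , _
    ... | 2F | _ , () , _
    ... | 4F | _ , () , _

    m2 : B 2F → m 2F ≡ 1F ⊎ m 2F ≡ 3F
    m2 B2 with m 2F | mated 2F B2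
    ... | 1F | _ = inj₁ refl
    ... | 3F | _ = inj₂ refl
    ... | 0F | _ , () , _
    ... | 2F | _ , () , _
    ... | 4F | _ , () , _

    m3 : B 3F → m 3F ≡ 4F ⊎ m 3F ≡ 2F
    m3 B3 with m 3F | mated 3F B3
    ... | 4F | _ = inj₁ refl
    ... | 2F | _ = inj₂ refl
    ... | 0F | _ , () , _
    ... | 1F | _ , () , _
    ... | 3F | _ , () , _

    follow : ∀ {x y} → m x ≡ y → B x → B y
    follow {x} eq Bx = subst B eq (proj₁ (mated x Bx))

    back : ∀ {x y} → m x ≡ y → B x → m y ≡ x
    back {x} eq Bx = trans (cong m (sym eq)) (proj₂ (proj₂ (mated x Bx)))

    -- If 4 is dominated by 3, then 3 is matched with 4 or with 2. The latter is impossible, because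
    -- `m1` already matches 2 with 1.
    1⇒4 : B 1F → B 4F
    1⇒4 B1 with dominated 4F
    ... | inj₁ B4 = B4
    ... | inj₂ (0F , B0 , _) = contradiction B0 ¬B0
    ... | inj₂ (1F , _ , ())
    ... | inj₂ (2F , _ , ())
    ... | inj₂ (4F , _ , ())
    ... | inj₂ (3F , B3 , _) with m3 B3
    ...   | inj₁ eq = follow eq B3
    ...   | inj₂ eq with trans (sym (back eq B3)) (back (m1 B1) B1)
    ...     | ()

    4⇒1 : B 4F → B 1F
    4⇒1 B4 with dominated 1F
    ... | inj₁ B1 = B1
    ... | inj₂ (0F , B0 , _) = contradiction B0 ¬B0
    ... | inj₂ (1F , _ , ())
    ... | inj₂ (3F , _ , ())
    ... | inj₂ (4F , _ , ())
    ... | inj₂ (2F , B2 , _) with m2 B2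
    ...   | inj₁ eq = follow eq B2
    ...   | inj₂ eq with trans (sym (back eq B2)) (back (m4 B4) B4)
    ...     | ()

    -- The excluded vertex 0 must be dominated by 1 or 4, and each of these forces the other into
    -- `B`.
    B1 : B 1F
    B1 with dominated 0F
    ... | inj₁ B0 = contradiction B0 ¬B0
    ... | inj₂ (1F , B1 , _) = B1
    ... | inj₂ (4F , B4 , _) = 4⇒1 B4

    all : ∀ {y} → y ≢ 0F → B y
    all {0F} y≢ = contradiction refl y≢
    all {1F} _ = B1
    all {2F} _ = follow (m1 B1) B1
    all {3F} _ = follow (m4 (1⇒4 B1)) (1⇒4 B1)
    all {4F} _ = 1⇒4 B1

  private
    mirror-ok : ∀ x → x ≢ 0F → mirror x ≢ 0F × mirror x ≢ x × Adj (cycleGraph 5) x (mirror x)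
    mirror-ok = toWitness {a? = Fin.all? λ x → ¬? (x Fin.≟ 0F) →-dec
      (¬? (mirror x Fin.≟ 0F) ×-dec ¬? (mirror x Fin.≟ x) ×-dec (cycleGraph 5 x (mirror x) Bool.≟ true))} _

  open HubComplement M simple 0F mirror
    (λ x≢ → proj₁ (mirror-ok _ x≢)) (λ x≢ → proj₁ (proj₂ (mirror-ok _ x≢)))
    (toWitness {a? = Fin.all? λ x → mirror (mirror x) Fin.≟ x} _)
    (λ x≢ → proj₂ (proj₂ (mirror-ok _ x≢))) {1F} (λ ()) refl Rigid.all using (minimalPaired)

  -- Pull `D` back to a subset `B` of C₅; a redundant vertex of `B` would be redundant in `D`.
  ∣D∣≤2 : ∀ {D} → MinimalDominating G D → ∣ D ∣ ≤ 2
  ∣D∣≤2 {D} minD = ℕ.≤-trans (injection⇒∣∣≤ D B code (λ v∈D → ∈⟦⟧⁺ B? (subst (_∈ D) (sym (vertex-code _)) v∈D))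
      λ _ _ eq → trans (sym (vertex-code _)) (trans (cong vertex eq) (vertex-code _)))
    (case C₅.small⊎redundant B of λ where
      (inj₁ small) → small
      (inj₂ (i , i∈B , redundant)) → contradiction (λ v i≼v → lift v (redundant (code v) (toModel v i≼v)))
        (minimalDominating⇒irredundant minD (∈⟦⟧⁻ B? i∈B)))
    where
    open SimpleGraph (cycleGraph 5) C₅-simple using () renaming (_≼_ to _≼₅_)
    B? : Decidable (λ i → vertex i ∈ D)
    B? i = vertex i ∈? D
    B : Subset 5
    B = ⟦ B? ⟧
    toModel : ∀ {i} v → vertex i ≼ v → i ≼₅ code v
    toModel v (inj₁ refl) = inj₁ (sym (code-vertex _))
    toModel v (inj₂ i~v) = inj₂ (Equivalence.to (adj⇔ _ _) (subst (_ ~_) (sym (vertex-code v)) i~v))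
    fromModel : ∀ {i} v → i ≼₅ code v → vertex i ≼ v
    fromModel v (inj₁ refl) = inj₁ (vertex-code v)
    fromModel v (inj₂ e) = inj₂ (subst (_ ~_) (vertex-code v) (Equivalence.from (adj⇔ _ _) e))
    lift : ∀ {i} v → (∃ λ k → k ∈ B × k ≢ i × k ≼₅ code v) →
      ∃ λ z → z ∈ D × z ≢ vertex i × z ≼ v
    lift v (k , k∈B , k≢i , k≼v) = vertex k , ∈⟦⟧⁻ B? k∈B , k≢i ∘ injective , fromModel v k≼v

  Γpr≡2Γ : ∀ {γ γpr} → n ≡ 5 → IsUpperDomination G γ → IsUpperPairedDomination G γpr → γpr ≡ 2 * γ
  Γpr≡2Γ refl maxΓ@((D , minD , refl) , _) maxΓpr =
    odd⇒Γpr≡2Γ {k = 2} simple maxΓ maxΓpr minimalPaired refl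
      (ℕ.≤-trans (ℕ.*-monoʳ-≤ 2 (∣D∣≤2 minD)) (ℕ.n≤1+n 4))

theorem11 : (n : ℕ) (G : Graph n) → IsSimple G → Unicyclic G →
    (γ γpr : ℕ) → IsUpperDomination G γ → IsUpperPairedDomination G γpr →
    (γpr ≡ 2 * γ) ⇔ (G ≅ cycleGraph 3 ⊎ G ≅ cycleGraph 5 ⊎ ∃ λ t → G ≅ subdividedStarTriangle t)
theorem11 n G simple unicyclic γ γpr maxΓ maxΓpr@((D , minD , ∣D∣≡) , _) = mk⇔ forward backward
  where
  forward : γpr ≡ 2 * γ → G ≅ cycleGraph 3 ⊎ G ≅ cycleGraph 5 ⊎ ∃ λ t → G ≅ subdividedStarTriangle t
  forward γpr≡ with Forward.2Γ⇒C₅⊎spider G simple unicyclic minD maxΓ (trans ∣D∣≡ γpr≡)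
  ... | inj₁ M = inj₂ (inj₁ (models⇒≅ M (self-model (cycleGraph 5))))
  -- Here C₃ appears as the spider with `t` equal to 0.
  ... | inj₂ (t , M) = inj₂ (inj₂ (t , models⇒≅ M (SpiderModel.model t)))

  backward : G ≅ cycleGraph 3 ⊎ G ≅ cycleGraph 5 ⊎ (∃ λ t → G ≅ subdividedStarTriangle t) → γpr ≡ 2 * γ
  backward (inj₁ G≅C₃) = SpiderParameters.Γpr≡2Γ simple
    (≅⇒model G≅C₃ (≅⇒model C₃≅spider₀ (SpiderModel.model 0))) (↔⇒≡ (proj₁ G≅C₃)) maxΓ maxΓpr
  backward (inj₂ (inj₁ G≅C₅)) = C₅Parameters.Γpr≡2Γ simple
    (≅⇒model G≅C₅ (self-model (cycleGraph 5))) (↔⇒≡ (proj₁ G≅C₅)) maxΓ maxΓpr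
  backward (inj₂ (inj₂ (t , G≅K))) = SpiderParameters.Γpr≡2Γ simple
    (≅⇒model G≅K (SpiderModel.model t)) (↔⇒≡ (proj₁ G≅K)) maxΓ maxΓpr
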